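{- Let $r\ge 1$ and let $\mathbf m=(m_1,\dots,m_r)\in\mathcal M_r$ be a Motzkin path. Let $T_{\mathbf m}$ be the transfer matrix of the weighted graph $\Gamma_{\mathbf m}$ and $T'_{\mathbf m}$ the $(r+1)\times(r+1)$ transfer matrix of the compactified weighted graph $\Gamma'_{\mathbf m}$. Then, as formal power series in $t$, $$\big((I-T_{\mathbf m})^{ -1}\big)_{1,1}=\big((I-T'_{\mathbf m})^{ -1}\big)_{1,1}.$$ That is, the partition function of weighted paths from vertex $1$ to vertex $1$ on $\Gamma_{\mathbf m}$ equals that of weighted paths from vertex $1$ to vertex $1$ on $\Gamma'_{\mathbf m}$.
   Context: Motzkin paths: $\mathcal M_r$ is the set of integer vectors $\mathbf m=(m_1,\dots,m_r)$ with $|m_\alpha-m_{\alpha+1}|\le 1$ for $1\le\alpha<r$ and $\min_\alpha m_\alpha=0$. $Q$-system: $\{R_{\alpha,n}\}_{0\le\alpha\le r+1,n\in\mathbb Z}$ is the solution of $R_{\alpha,n+1}R_{\alpha,n-1}=R_{\alpha,n}^2+R_{\alpha+1,n}R_{\alpha-1,n}$ ($1\le\alpha\le r$), $R_{0,n}=R_{r+1,n}=1$, with initial data $R_{\alpha,0},R_{\alpha,1}$ ($1\le\alpha\le r$) independent indeterminates. Skeleton weights: put $\lambda_{\alpha,n}=R_{\alpha,n+1}/R_{\alpha,n}$ and $\mu_{\alpha,n}=R_{\alpha,n}/R_{\alpha-1,n}$. For $1\le \alpha\le r+1$, $y_{2\alpha-1}(\mathbf m)=\lambda_{\alpha,m_\alpha}/\lambda_{\alpha-1,m_{\alpha-1}}$;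 for $1\le\alpha\le r$, $y_{2\alpha}(\mathbf m)=\frac{\mu_{\alpha+1,m_\alpha+1}}{\mu_{\alpha,m_\alpha}}\,A_\alpha B_\alpha$, where $A_\alpha=\lambda_{\alpha+1,m_{\alpha+1}}/\lambda_{\alpha+1,m_\alpha}$ if $m_\alpha=m_{\alpha+1}+1$ and $A_\alpha=1$ otherwise, and $B_\alpha=\lambda_{\alpha-1,m_\alpha}/\lambda_{\alpha-1,m_{\alpha-1}}$ if $m_{\alpha-1}=m_\alpha+1$ and $B_\alpha=1$ otherwise. (Since $\lambda_{0,n}=\lambda_{r+1,n}=1$, the values of $m_0,m_{r+1}$ are irrelevant.) Write $y_j=y_j(\mathbf m)$. Transfer matrix: for a graph with weighted oriented edges, the entry of the transfer matrix in row $b$, column $a$ is the weight of the oriented edge $a\to b$ (and $0$ if there is none). The graph $\widetilde G_k$ ($k\ge 1$) is the tree with $2k+2$ vertices $0,1,2,2',3,3',\dots,k,k',k+1,k+2$ and $2k+1$ edges labelled as follows: edge $1$ is $(0,1)$; edge $2j$ is $(j,j+1)$ for $1\le j\le k$; edge $2j-1$ is $(j,j')$ for $2\le j\le k$; edge $2k+1$ is $(k+1,k+2)$. Definition of $\Gamma_{\mathbf m}$: decompose $\{1,\dots,r\}$ into maximal strings of consecutive indices $\{\alpha_i,\alpha_i+1,\dots,\alpha_{i+1}-1\}$, $i=1,\dots,p$, $\alpha_1=1$, $\alpha_{p+1}=r+1$, along which $\mathbf m$ descends by exactly $1$ at each step ($m_{\alpha_i+j}=m_{\alpha_i}-j$);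 let $k_i=\alpha_{i+1}-\alpha_i\ge 1$. Between consecutive strings the separation is either flat ($m_{\alpha_{i+1}}=m_{\alpha_{i+1}-1}$) or ascending ($m_{\alpha_{i+1}}=m_{\alpha_{i+1}-1}+1$). Let $\Gamma_{\mathbf m_i}$ be $\widetilde G_{k_i}$ together with additional oriented edges $a\to b$ for all integers $a,b$ with $b\ge 1$, $b+2\le a\le k_i+1$. Glue $\Gamma_{\mathbf m_{i}}$ to $\Gamma_{\mathbf m_{i+1}}$ for $i=1,\dots,p-1$: if the separation is flat, identify vertex $0$ (resp. $1$) of $\Gamma_{\mathbf m_{i+1}}$ with vertex $k_i+2$ (resp. $k_i+1$) of $\Gamma_{\mathbf m_i}$; if ascending, identify vertex $0$ (resp. $1$) of $\Gamma_{\mathbf m_{i+1}}$ with vertex $k_i+1$ (resp. $k_i+2$) of $\Gamma_{\mathbf m_i}$; in both cases the edge $(0,1)$ of $\Gamma_{\mathbf m_{i+1}}$ is identified with the edge $(k_i+1,k_i+2)$ of $\Gamma_{\mathbf m_i}$. The result is $\Gamma_{\mathbf m}$; its root (vertex $0$) and its vertex $1$ are the vertices $0$ and $1$ of $\Gamma_{\mathbf m_1}$. Its skeleton (the union of the $\widetilde G_{k_i}$) is a tree with $2r+2$ vertices and $2r+1$ edges; the edge labelled $j$ in $\widetilde G_{k_i}$ gets label $j+2(\alpha_i-1)$ in $\Gamma_{\mathbf m}$. Each skeleton edge with label $j$ is regarded as two oriented edges: the one pointing toward the root has weight $t\,y_j$, the one pointing away from the root has weight $1$. An additional edge $a\to b$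 of $\Gamma_{\mathbf m_i}$ has weight $t\,\prod_{b\le c<a}w_{c+1,c}\big/\prod_{b<c<a}w_{c',c}$, where $w_{c+1,c}$ and $w_{c',c}$ denote the weights $y_j$ attached to the skeleton edges $(c,c+1)$ and $(c,c')$ of $\Gamma_{\mathbf m_i}$. Definition of $\Gamma'_{\mathbf m}$: vertices $1,\dots,r+1$; oriented edges $i\to i+1$ with weight $1$ and $i+1\to i$ with weight $t y_{2i}$ ($1\le i\le r$); loops $i\to i$ with weight $t y_{2i-1}$ ($1\le i\le r+1$). In addition: for every maximal descending segment of $\mathbf m$ of length $i\ge 2$ (maximal set of consecutive indices $\alpha,\alpha+1,\dots,\alpha+i-1$ with $m_{\alpha+j}=m_\alpha-j$), add edges $\alpha+p\to\alpha+q$ for all $0\le q$, $q+2\le p\le i$, with weight $t\,\prod_{j=\alpha+q}^{\alpha+p-1}y_{2j}\big/\prod_{j=\alpha+q+1}^{\alpha+p-1}y_{2j-1}$; for every maximal ascending segment of length $i\ge2$ (maximal set of consecutive indices $\alpha,\dots,\alpha+i-1$ with $m_{\alpha+j}=m_\alpha+j$), add edges $\alpha+q\to\alpha+p$ for all $0\le q$, $q+2\le p\le i$, with weight $(-1)^{p-q-1}$. -}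

module Defs where

open import Level using (Level; _⊔_)
open import Algebra.Apartness.Bundles using (HeytingField; HeytingCommutativeRing)
open import Algebra.Bundles using (CommutativeRing)
open import Algebra.Bundles.Raw using (RawRing)
import Algebra.Apartness.Properties.HeytingCommutativeRing as HeytingProperties
open import Algebra.Definitions using (Invertible)
import Algebra.Definitions.RawSemiring as RawSemiringDefs
open import Data.Bool.Base using (if_then_else_; _∧_)
open import Data.Fin.Base using (Fin; toℕ)
import Data.Fin.Properties as Fin
open import Data.Integer.Base as ℤ using (ℤ; +_; -[1+_]; 0ℤ; 1ℤ; -1ℤ; ∣_∣)
import Data.Integer.Properties as ℤ
open import Data.List.Base as List using (List; []; _∷_; [_]; _++_; concatMap; filterᵇ; foldr; upTo)
open import Data.List.Relation.Unary.Any using (Any)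
open import Data.List.Relation.Unary.Unique.Propositional using (Unique)
open import Data.Nat.Base using (ℕ; zero; suc; pred; _+_; _*_; _∸_; _≤_; _<_; _≡ᵇ_)
open import Data.Product.Base using (Σ; _×_; _,_; proj₁; proj₂)
open import Data.Vec.Base as Vec using (Vec; []; _∷_; toList)
import Data.Vec.Functional as Vector
open import Data.Vec.Membership.Propositional using (_∈_)
open import Data.Vec.Relation.Unary.All using (All)
open import Relation.Binary.PropositionalEquality using (_≢_)
open import Relation.Nullary.Decidable using (⌊_⌋)

private variable
  c ℓ ℓ₁ ℓ₂ : Level

-- The integers a, a+1, …, b (none if b < a).
range : ℕ → ℕ → List ℕ
range a b = List.map (λ i → a + i) (upTo (suc b ∸ a))

------------------------------------------------------------------------
-- Formal power series in t, and square matrices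

module _ (𝓡 : RawRing c ℓ) where
  open RawRing 𝓡
    using (Carrier; _≈_; 0#; 1#; -_; rawSemiring) renaming (_+_ to _⊕_; _*_ to _⊗_)
  open RawSemiringDefs rawSemiring using (sum)

  constant : Carrier → (ℕ → Carrier)
  constant x zero    = x
  constant x (suc _) = 0#

  t· : Carrier → (ℕ → Carrier)
  t· x zero    = 0#
  t· x (suc n) = constant x n

  -- f n is the coefficient of tⁿ.
  powerSeries : RawRing c ℓ
  powerSeries = record
    { Carrier = ℕ → Carrier
    ; _≈_     = λ f g → ∀ n → f n ≈ g n
    ; _+_     = λ f g n → f n ⊕ g n
    ; _*_     = λ f g n → sum {suc n} (λ i → f (toℕ i) ⊗ g (n ∸ toℕ i))
    ; -_      = λ f n → - f n
    ; 0#      = constant 0#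
    ; 1#      = constant 1#
    }

  -- M b a is the entry in row b and column a.
  matrix : ℕ → RawRing c ℓ
  matrix N = record
    { Carrier = Fin N → Fin N → Carrier
    ; _≈_     = λ M M′ → ∀ b a → M b a ≈ M′ b a
    ; _+_     = λ M M′ b a → M b a ⊕ M′ b a
    ; _*_     = λ M M′ b a → sum (λ i → M b i ⊗ M′ i a)
    ; -_      = λ M b a → - M b a
    ; 0#      = λ _ _ → 0#
    ; 1#      = λ b a → if ⌊ b Fin.≟ a ⌋ then 1# else 0#
    }

------------------------------------------------------------------------
-- Motzkin paths

-- m ⟨ α ⟩ = m_α for 1 ≤ α ≤ r.  The values m₀ and m_{r+1}, which are
-- irrelevant, are taken to be 0.
infix 9 _⟨_⟩

_⟨_⟩ : ∀ {r} → Vec ℤ r → ℕ → ℤ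
[]       ⟨ _ ⟩           = 0ℤ
(x ∷ xs) ⟨ zero ⟩        = 0ℤ
(x ∷ xs) ⟨ suc zero ⟩    = x
(x ∷ xs) ⟨ suc (suc α) ⟩ = xs ⟨ suc α ⟩

record IsMotzkin {r} (m : Vec ℤ r) : Set where
  field
    step    : ∀ α → 1 ≤ α → α < r → ∣ m ⟨ α ⟩ ℤ.- m ⟨ suc α ⟩ ∣ ≤ 1
    bounded : All (0ℤ ℤ.≤_) m
    attains : 0ℤ ∈ m

-- The set of consecutive indices before+1, …, before+len.
record Segment : Set where
  constructor segment
  field
    before len : ℕ

-- Adjoins to the first segment the index just before it.
extend : List Segment → List Segment
extend []                  = []
extend (segment o k ∷ sgs) = segment (pred o) (suc k) ∷ sgs

-- The maximal segments along which consecutive entries differ by exactly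
-- ε, from left to right, for a list whose first entry has index o+1.
-- They partition the indices; segments of length 1 are included.
segmentsFrom : ℤ → ℕ → List ℤ → List Segment
segmentsFrom ε o []           = []
segmentsFrom ε o (x ∷ [])     = [ segment o 1 ]
segmentsFrom ε o (x ∷ y ∷ xs) =
  if ⌊ y ℤ.≟ x ℤ.+ ε ⌋
  then extend (segmentsFrom ε (suc o) (y ∷ xs))
  else segment o 1 ∷ segmentsFrom ε (suc o) (y ∷ xs)

descending ascending : ∀ {r} → Vec ℤ r → List Segment
descending m = segmentsFrom -1ℤ 0 (toList m)
ascending  m = segmentsFrom 1ℤ 0 (toList m)

------------------------------------------------------------------------
-- The tree G̃ₖ

-- spine j is the vertex j, and prime j is the vertex j′.
data Vertex : Set where
  spine prime : ℕ → Vertex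

-- Edge labels and indices of the weights y, split by parity:
-- odd α stands for 2α-1, and even α stands for 2α.
data Label : Set where
  odd even : ℕ → Label

-- _+2·_ adds 2o to a label.
_+2·_ : Label → ℕ → Label
odd  α +2· o = odd  (o + α)
even α +2· o = even (o + α)

-- An edge of a rooted tree; near is its endpoint closer to the root.
record TreeEdge (V : Set) : Set where
  constructor treeEdge
  field
    near far : V
    label    : Label

-- The edges of G̃ₖ with labels 2, …, 2k+1.  The root of Γ_m is always on
-- the side of the remaining edge (0,1) of G̃ₖ, because the vertices 0
-- and 1 are those by which G̃ₖ is glued to the preceding part of Γ_m.
branches : ℕ → List (TreeEdge Vertex)
branches k =
  List.map (λ j → treeEdge (spine j) (spine (suc j)) (even j)) (range 1 k) ++
  List.map (λ j → treeEdge (spine j) (prime j) (odd j)) (range 2 k) ++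
  [ treeEdge (spine (k + 1)) (spine (k + 2)) (odd (k + 1)) ]

-- Vertices of Γ_m are numbered 0, …, 2r+1: a string o+1, …, o+k
-- contributes its vertices 2,2′,3,3′,…,k,k′,k+1,k+2 in this order, with
-- the numbers 2(o+1), …, 2(o+k)+1, while its vertices 0 and 1 are
-- identified with the existing vertices v₀ and v₁.
place : (v₀ v₁ : ℕ) → Segment → Vertex → ℕ
place v₀ v₁ (segment o k) (spine zero)          = v₀
place v₀ v₁ (segment o k) (spine (suc zero))    = v₁
place v₀ v₁ (segment o k) (spine (suc (suc j))) =
  if j ≡ᵇ k then suc (2 * (o + k)) else 2 * (o + suc j)
place v₀ v₁ (segment o k) (prime j)             = pred (2 * (o + j))

------------------------------------------------------------------------
-- Elements of a field

module FieldDefs (F : HeytingField c ℓ₁ ℓ₂) where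
  open HeytingField F
    using (Carrier; _≈_; _#_; 0#; 1#; -_; trans; *-congˡ; #⇒invertible; heytingCommutativeRing)
    renaming (_+_ to _⊕_; _*_ to _⊗_)
  open HeytingCommutativeRing heytingCommutativeRing using (commutativeRing)
  open HeytingProperties heytingCommutativeRing
    using (1#0; x-0≈x; x#0y#0→xy#0; invertibleˡ⇒#)

  rawRing : RawRing c ℓ₁
  rawRing = CommutativeRing.rawRing commutativeRing

  open RawSemiringDefs (RawRing.rawSemiring rawRing) using (_^_; product)
    renaming (_×_ to _×ℕ_)

  _×ℤ_ : ℤ → Carrier → Carrier
  (+ n)    ×ℤ x = n ×ℕ x
  -[1+ n ] ×ℤ x = - (suc n ×ℕ x)

  -- Polynomials over ℤ in N variables, as lists of terms consisting of a
  -- coefficient and a vector of exponents.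
  Polynomial : ℕ → Set
  Polynomial N = List (ℤ × Vec ℕ N)

  evaluate : ∀ {N} → (Fin N → Carrier) → Polynomial N → Carrier
  evaluate x = foldr (λ (a , e) s → (a ×ℤ product (λ i → x i ^ Vec.lookup e i)) ⊕ s) 0#

  -- Algebraic independence over the prime field: a polynomial over ℤ
  -- with distinct monomials and a nonzero coefficient does not vanish.
  -- In particular, the field then has characteristic 0.
  AlgebraicallyIndependent : ∀ {N} → (Fin N → Carrier) → Set ℓ₂
  AlgebraicallyIndependent {N} x = (f : Polynomial N) →
    Unique (List.map proj₂ f) → Any (λ (a , _) → a ≢ 0ℤ) f → evaluate x f # 0#

  NonzeroElement : Set (c ⊔ ℓ₂)
  NonzeroElement = Σ Carrier (_# 0#)

  -- The proofs are abstract to keep them out of type checking.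
  abstract
    one-nonzero : 1# # 0#
    one-nonzero = 1#0

    product-nonzero : ∀ {x y} → x # 0# → y # 0# → x ⊗ y # 0#
    product-nonzero = x#0y#0→xy#0

    inverse-nonzero : ∀ {x} (x#0 : x # 0#) → proj₁ (#⇒invertible x#0) # 0#
    inverse-nonzero x#0 = let (x⁻¹ , _ , xx⁻¹≈1) = #⇒invertible x#0 in
      invertibleˡ⇒# (_ , trans (*-congˡ (x-0≈x x⁻¹)) xx⁻¹≈1)

  infixl 7 _·_ _/_

  one : NonzeroElement
  one = 1# , one-nonzero

  _·_ : NonzeroElement → NonzeroElement → NonzeroElement
  (x , x#0) · (y , y#0) = x ⊗ y , product-nonzero x#0 y#0

  inverse : NonzeroElement → NonzeroElement
  inverse (x , x#0) = proj₁ (#⇒invertible x#0) , inverse-nonzero x#0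

  _/_ : NonzeroElement → NonzeroElement → NonzeroElement
  x / y = x · inverse y

  ∏ : List ℕ → (ℕ → NonzeroElement) → NonzeroElement
  ∏ js f = foldr (λ j x → f j · x) one js

------------------------------------------------------------------------
-- The Q-system

  -- R_{1,0}, …, R_{r,0}, R_{1,1}, …, R_{r,1}
  initialData : ∀ r → (ℕ → ℤ → Carrier) → Fin (r + r) → Carrier
  initialData r R = column 0ℤ Vector.++ column 1ℤ
    where
    column : ℤ → Fin r → Carrier
    column n i = R (suc (toℕ i)) n

  -- The indices α outside {0,…,r+1} play no role; R α n is 1 there.
  -- The relation determines the solution by division from its initial
  -- data, so that the R α n have to be nonzero; this is automatic, as
  -- they are subtraction-free rational functions of the initial data.
  record QSystem (r : ℕ) : Set (c ⊔ ℓ₁ ⊔ ℓ₂) where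
    field
      R           : ℕ → ℤ → Carrier
      nonzero     : ∀ α n → R α n # 0#
      lower       : ∀ n → R 0 n ≈ 1#
      upper       : ∀ α n → r < α → R α n ≈ 1#
      relation    : ∀ α n → 1 ≤ α → α ≤ r →
                    R α (n ℤ.+ 1ℤ) ⊗ R α (n ℤ.- 1ℤ) ≈
                    (R α n ⊗ R α n) ⊕ (R (suc α) n ⊗ R (pred α) n)
      independent : AlgebraicallyIndependent (initialData r R)

------------------------------------------------------------------------
-- The skeleton weights

  module SkeletonWeights {r : ℕ} (Q : QSystem r) (m : Vec ℤ r) where
    open QSystem Q

    R* ƛ μ : ℕ → ℤ → NonzeroElement
    R* α n = R α n , nonzero α n
    ƛ α n  = R* α (n ℤ.+ 1ℤ) / R* α n
    μ α n  = R* α n / R* (pred α) n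

    A B : ℕ → NonzeroElement
    A α = if ⌊ m ⟨ α ⟩ ℤ.≟ m ⟨ suc α ⟩ ℤ.+ 1ℤ ⌋
          then ƛ (suc α) (m ⟨ suc α ⟩) / ƛ (suc α) (m ⟨ α ⟩)
          else one
    B α = if ⌊ m ⟨ pred α ⟩ ℤ.≟ m ⟨ α ⟩ ℤ.+ 1ℤ ⌋
          then ƛ (pred α) (m ⟨ α ⟩) / ƛ (pred α) (m ⟨ pred α ⟩)
          else one

    y : Label → NonzeroElement
    y (odd α)  = ƛ α (m ⟨ α ⟩) / ƛ (pred α) (m ⟨ pred α ⟩)
    y (even α) = μ (suc α) (m ⟨ α ⟩ ℤ.+ 1ℤ) / μ α (m ⟨ α ⟩) · A α · B α

------------------------------------------------------------------------
-- The weighted graphs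

  -- An oriented edge between numbered vertices, weighted by a power
  -- series in t.
  record Edge : Set c where
    constructor edge
    field
      source target : ℕ
      weight        : ℕ → Carrier
  open Edge

  -- The transfer matrix of a graph whose N vertices have the given
  -- numbers.  The graphs below have no parallel edges, so that every
  -- entry is the weight of a single edge, or 0.
  transferMatrix : ∀ {N} → (Fin N → ℕ) → List Edge → Fin N → Fin N → (ℕ → Carrier)
  transferMatrix number es b a = foldr (λ e w → weight e +ₜ w) 0ₜ
    (filterᵇ (λ e → (source e ≡ᵇ number a) ∧ (target e ≡ᵇ number b)) es)
    where open RawRing (powerSeries rawRing) using () renaming (_+_ to _+ₜ_; 0# to 0ₜ)

  oneₜ : ℕ → Carrier
  oneₜ = constant rawRing 1#

  t*_ : NonzeroElement → (ℕ → Carrier)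
  t* x = t· rawRing (proj₁ x)

  module Graphs {r : ℕ} (m : Vec ℤ r) (y : Label → NonzeroElement) where

    -- ∏_{q ≤ j < p} y_{2j} / ∏_{q < j < p} y_{2j-1}
    redundant : (q p : ℕ) → NonzeroElement
    redundant q p = ∏ (range q (p ∸ 1)) (λ j → y (even j)) / ∏ (range (suc q) (p ∸ 1)) (λ j → y (odd j))

    orient : TreeEdge ℕ → List Edge
    orient (treeEdge near far j) = edge far near (t* y j) ∷ edge near far oneₜ ∷ []

    -- The edges of Γ_{m_i}, except for its skeleton edge (0,1).  The
    -- edges (c,c+1) and (c,c′) have the labels 2(o+c) and 2(o+c)-1.
    piece : (v₀ v₁ : ℕ) → Segment → List Edge
    piece v₀ v₁ s@(segment o k) =
      concatMap (λ (treeEdge near far j) → orient (treeEdge (φ near) (φ far) (j +2· o))) (branches k) ++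
      concatMap (λ a → List.map (λ b → edge (φ (spine a)) (φ (spine b)) (t* redundant (o + b) (o + a)))
                                (range 1 (a ∸ 2)))
                (range 3 (k + 1))
      where
      φ = place v₀ v₁ s

    -- The skeleton edge (0,1) of every string but the first is already
    -- present, as the last edge (k+1,k+2) of the preceding string.
    glue : (v₀ v₁ : ℕ) → List Segment → List Edge
    glue v₀ v₁ []                    = []
    glue v₀ v₁ (s@(segment o k) ∷ ss) = piece v₀ v₁ s ++
      (if ⌊ m ⟨ suc (o + k) ⟩ ℤ.≟ m ⟨ o + k ⟩ ℤ.+ 1ℤ ⌋
       then glue (φ (spine (k + 1))) (φ (spine (k + 2))) ss
       else glue (φ (spine (k + 2))) (φ (spine (k + 1))) ss)
      where
      φ = place v₀ v₁ s

    Γ : List Edge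
    Γ = orient (treeEdge 0 1 (odd 1)) ++ glue 0 1 (descending m)

    T : Fin (2 + 2 * r) → Fin (2 + 2 * r) → (ℕ → Carrier)
    T = transferMatrix toℕ Γ

    -- Segments of length 1 contribute no edge to the last two lists.
    Γ′ : List Edge
    Γ′ =
      concatMap (λ i → edge i (suc i) oneₜ ∷ edge (suc i) i (t* y (even i)) ∷ []) (range 1 r) ++
      List.map (λ i → edge i i (t* y (odd i))) (range 1 (suc r)) ++
      concatMap (λ (segment o i) →
        concatMap (λ p → List.map (λ q → edge (suc o + p) (suc o + q) (t* redundant (suc o + q) (suc o + p)))
                                  (range 0 (p ∸ 2)))
                  (range 2 i))
        (descending m) ++
      concatMap (λ (segment o i) →
        concatMap (λ p → List.map (λ q → edge (suc o + q) (suc o + p) (constant rawRing ((- 1#) ^ (p ∸ q ∸ 1))))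
                                  (range 0 (p ∸ 2)))
                  (range 2 i))
        (ascending m)

    -- The vertex 1 of Γ′ has the matrix index 0.
    T′ : Fin (suc r) → Fin (suc r) → (ℕ → Carrier)
    T′ = transferMatrix (λ i → suc (toℕ i)) Γ′

------------------------------------------------------------------------
-- Inverses of matrices of power series

  -- Invertible yields a two-sided, hence unique, inverse.
  Resolvent : ∀ {N} → (Fin N → Fin N → (ℕ → Carrier)) → Set (c ⊔ ℓ₁)
  Resolvent {N} M = Invertible _≈ₘ_ Iₘ _*ₘ_ (Iₘ +ₘ (-ₘ M))
    where
    open RawRing (matrix (powerSeries rawRing) N)
      renaming (_≈_ to _≈ₘ_; 1# to Iₘ; _*_ to _*ₘ_; _+_ to _+ₘ_; -_ to -ₘ_)

{-# OPTIONS --safe #-}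
module Submission where

-- The row of (I - T′)⁻¹ with index 1 is the unique solution of
--   z_a = δ_{a,1} + Σ_{a → b} w(a → b) z_b,   1 ≤ a ≤ r + 1,
-- and likewise for Γ, so it suffices to turn z into a solution Z of the
-- equations for Γ with Z_1 = z_1.  Let S_j = z_{j+1} - z_{j+2} + … be the
-- sum over the edges of Γ′ from j to larger vertices.  Then
-- S_j + S_{j+1} = z_{j+1} if m_{j+1} = m_j + 1, and S_j = z_{j+1} otherwise.
-- Let c_j be the product of t y_{2i-1} over 2 ≤ i ≤ j with m_i = m_{i-1} + 1;
-- it is constant along every descending string.  A vertex j of Γ′ at which
-- m does not ascend comes from one vertex of Γ, where Z is c_j z_j, and from
-- a leaf.  A vertex j at which m ascends comes from two vertices of Γ joined
-- by the edge 2j-1, where Z is c_{j-1} S_{j-1} and c_j z_j, respectively.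

open import Defs
open import Level using (Level)
open import Algebra.Apartness.Bundles using (HeytingField; HeytingCommutativeRing)
open import Algebra.Bundles using (CommutativeRing; AbelianGroup)
open import Algebra.Bundles.Raw using (RawRing)
import Algebra.Construct.Pointwise as Pointwise
open import Algebra.Definitions using (Invertible)
import Algebra.Definitions.RawSemiring as RawSemiringDefs
import Algebra.Properties.AbelianGroup as AbelianGroupProperties
import Algebra.Properties.CommutativeSemigroup as CommutativeSemigroupProperties
import Algebra.Properties.Ring as RingProperties
import Algebra.Properties.Semiring.Sum as SemiringSum
import Algebra.Solver.CommutativeMonoid as CommutativeMonoidSolver
open import Data.Bool.Base as Bool using (Bool; if_then_else_; true; false; _∧_)
open import Data.Fin.Base using (Fin; zero; suc; toℕ; fromℕ<)
import Data.Fin.Properties as Fin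
open import Data.Integer.Base as ℤ using (ℤ; 0ℤ; 1ℤ; -1ℤ)
import Data.Integer.Properties as ℤ
open import Data.List.Base as List using (List; []; _∷_; [_]; _++_; concat; concatMap; foldr; applyUpTo)
import Data.List.Properties as List
open import Data.List.Relation.Binary.Permutation.Propositional as ↭
  using (_↭_; ↭-refl; ↭-reflexive; ↭-sym; ↭-trans)
open import Data.List.Relation.Binary.Permutation.Propositional.Properties
  using (++-commutativeMonoid; ++⁺ˡ; shifts; All-resp-↭)
open import Data.List.Relation.Unary.All as All using (All; []; _∷_)
import Data.List.Relation.Unary.All.Properties as All
open import Data.Nat.Base as ℕ
  using (ℕ; zero; suc; pred; _+_; _*_; _∸_; _≤_; _<_; _≡ᵇ_; z≤n; s≤s; s≤s⁻¹)
import Data.Nat.Properties as ℕ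
open import Data.Product.Base using (Σ-syntax; _×_; _,_; proj₁)
open import Data.Sum.Base using (_⊎_; inj₁; inj₂)
open import Data.Vec.Base using (Vec; []; _∷_; toList)
open import Function.Base using (_∘_)
open import Relation.Binary.PropositionalEquality as ≡ using (_≡_; _≢_)
import Relation.Binary.Reasoning.Setoid as SetoidReasoning
open import Relation.Nullary.Decidable using (⌊_⌋; yes; no)
open import Relation.Nullary.Negation using (contradiction)

-- Where the values for Γ come from: at an ascent, vertex j of Γ′ becomes a pair E, O joined by the
-- edge 2j-1. Steps to smaller vertices leave from E, steps to larger ones from O, so E = back + O
-- and O = t y_{2j-1} E + next. If E = c S_{j-1}, then S_{j-1} + S_j = z_j gives O = c t y_{2j-1}
-- z_j, provided that next = c t y_{2j-1} S_j. So each ascent multiplies everything beyond it by one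
-- more factor, and nothing is ever divided by it. Additional edges stay within a descending string,
-- where the factor is constant, and have the same weights in both graphs.
--
-- Existence and uniqueness of the rows need care because some edges carry no t, so that I - T is
-- not I plus a multiple of t. All those edges lead to larger vertex numbers; hence the constant
-- part of T is strictly triangular.
--
-- The recursive gluing is the other obstacle. With the chosen numbering, the edge list of Γ is, up
-- to permutation, given by formulas in which the gluing shows only through the positions of the
-- ascents.

private variable
  a : Level
  X Y : Set a

-- Lists and parity

≡ᵇ-refl : ∀ n → (n ≡ᵇ n) ≡ true
≡ᵇ-refl zero    = ≡.refl
≡ᵇ-refl (suc n) = ≡ᵇ-refl n

≡ᵇ-true : ∀ {m n} → (m ≡ᵇ n) ≡ true → m ≡ n
≡ᵇ-true {m} {n} eq = ℕ.≡ᵇ⇒≡ m n (≡.subst Bool.T (≡.sym eq) _)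

≡ᵇ-false : ∀ {m n} → m ≢ n → (m ≡ᵇ n) ≡ false
≡ᵇ-false {m} {n} m≢n with m ≡ᵇ n in eq
... | true  = contradiction (≡ᵇ-true eq) m≢n
... | false = ≡.refl

-- The common form, indexed from 0, to which the edge lists over ranges are brought so that they can
-- be compared and regrouped.
block : (ℕ → List X) → ℕ → List X
block f n = concat (applyUpTo f n)

applyUpTo-cong : ∀ {f g : ℕ → X} n → (∀ i → i < n → f i ≡ g i) → applyUpTo f n ≡ applyUpTo g n
applyUpTo-cong zero    f≡g = ≡.refl
applyUpTo-cong (suc n) f≡g = ≡.cong₂ _∷_ (f≡g 0 (s≤s z≤n)) (applyUpTo-cong n λ i i<n → f≡g (suc i) (s≤s i<n))

block-cong : ∀ {f g : ℕ → List X} n → (∀ i → i < n → f i ≡ g i) → block f n ≡ block g n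
block-cong n f≡g = ≡.cong concat (applyUpTo-cong n f≡g)

block-+ : ∀ (f : ℕ → List X) k n → block f (k + n) ≡ block f k ++ block (λ i → f (k + i)) n
block-+ f zero    n = ≡.refl
block-+ f (suc k) n = ≡.trans (≡.cong (f 0 ++_) (block-+ (f ∘ suc) k n)) (≡.sym (List.++-assoc (f 0) _ _))

block-∷ʳ : ∀ (f : ℕ → List X) n → block f n ++ f n ≡ block f (suc n)
block-∷ʳ f zero    = ≡.sym (List.++-identityʳ (f 0))
block-∷ʳ f (suc n) = ≡.trans (List.++-assoc (f 0) _ _) (≡.cong (f 0 ++_) (block-∷ʳ (f ∘ suc) n))

map-block : ∀ (g : X → Y) (f : ℕ → List X) n → List.map g (block f n) ≡ block (List.map g ∘ f) n
map-block g f n = ≡.trans (≡.sym (List.concat-map (applyUpTo f n))) (≡.cong concat (List.map-applyUpTo f (List.map g) n))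

map-range : ∀ (f : ℕ → X) a b → List.map f (range a b) ≡ applyUpTo (λ i → f (a + i)) (suc b ∸ a)
map-range f a b = ≡.trans (≡.sym (List.map-∘ _)) (List.map-upTo (λ i → f (a + i)) (suc b ∸ a))

concatMap-range : ∀ (f : ℕ → List X) a b → concatMap f (range a b) ≡ block (λ i → f (a + i)) (suc b ∸ a)
concatMap-range f a b = ≡.cong concat (map-range f a b)

concatMap-map-range : ∀ (f : Y → List X) (g : ℕ → Y) a b →
                      concatMap f (List.map g (range a b)) ≡ block (λ i → f (g (a + i))) (suc b ∸ a)
concatMap-map-range f g a b = ≡.trans (List.concatMap-map f g (range a b)) (concatMap-range (f ∘ g) a b)

-- The ascent edges are listed by target; this collects those that leave the first vertex of a
-- segment.
block-∷-↭ : ∀ (f : ℕ → X) (g : ℕ → List X) n →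
            block (λ i → f i ∷ g i) n ↭ applyUpTo f n ++ block g n
block-∷-↭ f g zero    = ↭-refl
block-∷-↭ f g (suc n) = ↭.prep (f 0) (↭-trans
  (++⁺ˡ (g 0) (block-∷-↭ (f ∘ suc) (g ∘ suc) n))
  (shifts (g 0) (applyUpTo (f ∘ suc) n)))

interleave : (ℕ → X) → (ℕ → X) → ℕ → X
interleave f g zero          = f 0
interleave f g (suc zero)    = g 0
interleave f g (suc (suc n)) = interleave (f ∘ suc) (g ∘ suc) n

interleave-even : ∀ (f g : ℕ → X) i → interleave f g (2 * i) ≡ f i
interleave-even f g zero    = ≡.refl
interleave-even f g (suc i) = ≡.trans
  (≡.cong (interleave f g ∘ suc) (ℕ.+-suc i (i + 0))) (interleave-even (f ∘ suc) (g ∘ suc) i)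

interleave-odd : ∀ (f g : ℕ → X) i → interleave f g (suc (2 * i)) ≡ g i
interleave-odd f g zero    = ≡.refl
interleave-odd f g (suc i) = ≡.trans
  (≡.cong (λ x → interleave f g (suc (suc x))) (ℕ.+-suc i (i + 0))) (interleave-odd (f ∘ suc) (g ∘ suc) i)

parity : ∀ n → (Σ[ i ∈ ℕ ] n ≡ 2 * i) ⊎ (Σ[ i ∈ ℕ ] n ≡ suc (2 * i))
parity zero = inj₁ (0 , ≡.refl)
parity (suc n) with parity n
... | inj₁ (i , ≡.refl) = inj₂ (i , ≡.refl)
... | inj₂ (i , ≡.refl) = inj₁ (suc i , ≡.cong suc (≡.sym (ℕ.+-suc i (i + 0))))

-- Resolvents of matrices of power series of degree at most 1 in t

module LinearAlgebra {c ℓ : Level} (R : CommutativeRing c ℓ) where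
  open CommutativeRing R hiding (_+_; _*_; zero)
  open CommutativeRing R using () renaming (_+_ to infixl 6 _⊕_; _*_ to infixl 7 _⊗_)
  open RingProperties ring using (-0#≈0#; -‿distribˡ-*; -‿+-comm)
  open SemiringSum semiring
  open SetoidReasoning setoid

  sum-zero : ∀ {n} {f : Fin n → Carrier} → (∀ i → f i ≈ 0#) → sum f ≈ 0#
  sum-zero {n} f≈0 = trans (sum-cong-≋ f≈0) (sum-replicate-zero n)

  sum-single : ∀ {n} {f : Fin n → Carrier} k → (∀ i → i ≢ k → f i ≈ 0#) → sum f ≈ f k
  sum-single {f = f} zero    f≈0 = trans (+-congˡ (sum-zero λ i → f≈0 (suc i) λ ())) (+-identityʳ (f zero))
  sum-single {f = f} (suc k) f≈0 = trans
    (+-cong (f≈0 zero λ ()) (sum-single k λ i i≢k → f≈0 (suc i) (i≢k ∘ Fin.suc-injective)))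
    (+-identityˡ (f (suc k)))

  sum-⊖ : ∀ {n} (f : Fin n → Carrier) → sum (λ i → - f i) ≈ - sum f
  sum-⊖ {zero}  f = sym -0#≈0#
  sum-⊖ {suc n} f = trans (+-congˡ (sum-⊖ (f ∘ suc))) (-‿+-comm _ _)

  -- Strictly triangular matrices

  Matrix : ℕ → ℕ → Set c
  Matrix m n = Fin m → Fin n → Carrier

  infixl 7 _∙_
  _∙_ : ∀ {l m n} → Matrix l m → Matrix m n → Matrix l n
  (A ∙ B) b a = sum (λ i → A b i ⊗ B i a)

  ∙-assoc : ∀ {k l m n} (A : Matrix k l) (B : Matrix l m) (C : Matrix m n) →
            ∀ b a → ((A ∙ B) ∙ C) b a ≈ (A ∙ (B ∙ C)) b a
  ∙-assoc {k} {l} {m} A B C b a = begin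
    sum (λ j → sum (λ i → A b i ⊗ B i j) ⊗ C j a)   ≈⟨ sum-cong-≋ {m} (λ j → *-distribʳ-sum {l} (C j a) (λ i → A b i ⊗ B i j)) ⟩
    sum (λ j → sum (λ i → A b i ⊗ B i j ⊗ C j a))   ≈⟨ ∑-comm {m} {l} (λ j i → A b i ⊗ B i j ⊗ C j a) ⟩
    sum (λ i → sum (λ j → A b i ⊗ B i j ⊗ C j a))   ≈⟨ sum-cong-≋ {l} (λ i → sum-cong-≋ {m} (λ j → *-assoc (A b i) (B i j) (C j a))) ⟩
    sum (λ i → sum (λ j → A b i ⊗ (B i j ⊗ C j a))) ≈⟨ sum-cong-≋ {l} (λ i → *-distribˡ-sum {m} (A b i) (λ j → B i j ⊗ C j a)) ⟨
    sum (λ i → A b i ⊗ sum (λ j → B i j ⊗ C j a))   ∎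

  ∙-congˡ : ∀ {l m n} (A : Matrix l m) {B B′ : Matrix m n} → (∀ b a → B b a ≈ B′ b a) →
            ∀ b a → (A ∙ B) b a ≈ (A ∙ B′) b a
  ∙-congˡ A B≈B′ b a = sum-cong-≋ λ i → *-congˡ (B≈B′ i a)

  ∙-congʳ : ∀ {l m n} {A A′ : Matrix l m} (B : Matrix m n) → (∀ b a → A b a ≈ A′ b a) →
            ∀ b a → (A ∙ B) b a ≈ (A′ ∙ B) b a
  ∙-congʳ B A≈A′ b a = sum-cong-≋ λ i → *-congʳ (A≈A′ b i)

  I : ∀ {n} → Matrix n n
  I {n} = RawRing.1# (matrix rawRing n)

  I-diagonal : ∀ {n} (a : Fin n) → I a a ≡ 1#
  I-diagonal a with a Fin.≟ a
  ... | yes _ = ≡.refl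
  ... | no a≢a = contradiction ≡.refl a≢a

  I-off : ∀ {n} {b a : Fin n} → b ≢ a → I b a ≡ 0#
  I-off {b = b} {a} b≢a with b Fin.≟ a
  ... | yes b≡a = contradiction b≡a b≢a
  ... | no _  = ≡.refl

  I-suc : ∀ {n} (b a : Fin n) → I (suc b) (suc a) ≡ I b a
  I-suc b a with b Fin.≟ a
  ... | yes _ = ≡.refl
  ... | no _  = ≡.refl

  -- Row b and column a belong to an edge a → b, so for constant parts of transfer matrices this
  -- says that edges without t lead to larger vertices.
  StrictlyLower : ∀ {n} → Matrix n n → Set ℓ
  StrictlyLower L = ∀ b a → toℕ b ≤ toℕ a → L b a ≈ 0#

  minor : ∀ {n} → Matrix (suc n) (suc n) → Matrix n n
  minor L b a = L (suc b) (suc a)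

  minor-lower : ∀ {n} {L : Matrix (suc n) (suc n)} → StrictlyLower L → StrictlyLower (minor L)
  minor-lower lower b a b≤a = lower (suc b) (suc a) (s≤s b≤a)

  -- The inverse of I - L, by bordering the inverse for the minor of L.
  star : ∀ {n} → Matrix n n → Matrix n n
  star L zero    zero    = 1#
  star L zero    (suc a) = 0#
  star L (suc b) zero    = sum (λ i → star (minor L) b i ⊗ L (suc i) zero)
  star L (suc b) (suc a) = star (minor L) b a

  private
    x≈x⊕0 : ∀ {x y} → y ≈ 0# → x ≈ x ⊕ y
    x≈x⊕0 y≈0 = sym (trans (+-congˡ y≈0) (+-identityʳ _))

    x≈0⊕x : ∀ {x y} → y ≈ 0# → x ≈ y ⊕ x
    x≈0⊕x y≈0 = sym (trans (+-congʳ y≈0) (+-identityˡ _))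

    0⊗ : ∀ {x y} → x ≈ 0# → x ⊗ y ≈ 0#
    0⊗ x≈0 = trans (*-congʳ x≈0) (zeroˡ _)

    ⊗0 : ∀ {x y} → y ≈ 0# → x ⊗ y ≈ 0#
    ⊗0 y≈0 = trans (*-congˡ y≈0) (zeroʳ _)

  star-right : ∀ {n} (L : Matrix n n) → StrictlyLower L →
               ∀ b a → star L b a ≈ I b a ⊕ (L ∙ star L) b a
  star-right {n} L lower zero zero = x≈x⊕0 (sum-zero {n} λ i → 0⊗ {y = star L i zero} (lower zero i z≤n))
  star-right {n} L lower zero (suc a) = x≈x⊕0 (sum-zero {n} λ i → 0⊗ {y = star L i (suc a)} (lower zero i z≤n))
  star-right {suc n} L lower (suc b) zero = begin
    sum (λ i → star L′ b i ⊗ L (suc i) zero)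
      ≈⟨ sum-cong-≋ {n} (λ i → trans (*-congʳ (star-right L′ (minor-lower lower) b i)) (distribʳ _ _ _)) ⟩
    sum (λ i → I b i ⊗ L (suc i) zero ⊕ (L′ ∙ star L′) b i ⊗ L (suc i) zero)
      ≈⟨ ∑-distrib-+ {n} (λ i → I b i ⊗ L (suc i) zero) (λ i → (L′ ∙ star L′) b i ⊗ L (suc i) zero) ⟩
    sum (λ i → I b i ⊗ L (suc i) zero) ⊕ sum (λ i → (L′ ∙ star L′) b i ⊗ L (suc i) zero)
      -- The first column of `L` below the diagonal is treated as a matrix with one column. The term
      -- `L (suc b) zero ⊗ 1#` is the summand with index `zero` of `L ∙ star L`.
      ≈⟨ +-cong head (∙-assoc L′ (star L′) (λ i (_ : Fin 1) → L (suc i) zero) b zero) ⟩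
    L (suc b) zero ⊗ 1# ⊕ sum (λ i → L′ b i ⊗ star L (suc i) zero)
      ≈⟨ +-identityˡ _ ⟨
    0# ⊕ (L (suc b) zero ⊗ 1# ⊕ sum (λ i → L′ b i ⊗ star L (suc i) zero)) ∎
    where
    L′ = minor L
    head : sum (λ i → I b i ⊗ L (suc i) zero) ≈ L (suc b) zero ⊗ 1#
    head = trans (sum-single b λ i i≢b → 0⊗ (reflexive (I-off (i≢b ∘ ≡.sym))))
                 (trans (*-congʳ (reflexive (I-diagonal b))) (*-comm _ _))
  star-right L lower (suc b) (suc a) = trans
    (star-right (minor L) (minor-lower lower) b a)
    (+-cong (reflexive (≡.sym (I-suc b a))) (x≈0⊕x (zeroʳ _)))

  star-left : ∀ {n} (L : Matrix n n) → StrictlyLower L →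
              ∀ b a → star L b a ≈ I b a ⊕ (star L ∙ L) b a
  star-left {suc n} L lower zero a = trans (first a) (x≈x⊕0 (trans
      (+-cong (⊗0 (lower zero a z≤n)) (sum-zero {n} λ i → zeroˡ (L (suc i) a))) (+-identityˡ _)))
    where
    first : ∀ a → star L zero a ≈ I zero a
    first zero    = refl
    first (suc a) = refl
  star-left L lower (suc b) zero = trans (x≈0⊕x (⊗0 (lower zero zero z≤n))) (sym (+-identityˡ _))
  star-left L lower (suc b) (suc a) = trans
    (star-left (minor L) (minor-lower lower) b a)
    (+-cong (reflexive (≡.sym (I-suc b a))) (x≈0⊕x (⊗0 (lower zero (suc a) z≤n))))

  -- Back substitution: the equation at `a` only involves entries of larger index, so the tail
  -- solves the system of the minor and then determines the first entry. The general `e` leaves room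
  -- for the contribution of lower powers of t.
  lower-unique : ∀ {n} (L : Matrix n n) → StrictlyLower L → {f g e : Fin n → Carrier} →
                 (∀ a → f a ≈ e a ⊕ sum (λ b → L b a ⊗ f b)) →
                 (∀ a → g a ≈ e a ⊕ sum (λ b → L b a ⊗ g b)) → ∀ a → f a ≈ g a
  lower-unique {suc n} L lower {f} {g} {e} f-eq g-eq = λ { zero → first ; (suc a) → rest a }
    where
    drop : ∀ {h : Fin (suc n) → Carrier} → (∀ a → h a ≈ e a ⊕ sum (λ b → L b a ⊗ h b)) →
           ∀ a → h a ≈ e a ⊕ sum (λ b → L (suc b) a ⊗ h (suc b))
    drop h-eq a = trans (h-eq a) (+-congˡ (sym (x≈0⊕x (0⊗ (lower zero a z≤n)))))
    rest : ∀ a → f (suc a) ≈ g (suc a)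
    rest = lower-unique (minor L) (minor-lower lower) (drop f-eq ∘ suc) (drop g-eq ∘ suc)
    first : f zero ≈ g zero
    first = trans (drop f-eq zero) (trans (+-congˡ (sum-cong-≋ (λ b → *-congˡ (rest b)))) (sym (drop g-eq zero)))

  -- Power series of degree at most 1 in t as multipliers

  Series : Set c
  Series = ℕ → Carrier

  open RawRing (powerSeries rawRing) using () renaming
    (_≈_ to _≈ₜ_; _+_ to _+ₜ_; _*_ to _*ₜ_; -_ to -ₜ_; 0# to 0ₜ; 1# to 1ₜ)

  Linear : Series → Set ℓ
  Linear w = ∀ n → w (suc (suc n)) ≈ 0#

  -- The product w f of power series in case w is linear.
  act : Series → Series → Series
  act w f zero    = w 0 ⊗ f 0
  act w f (suc n) = w 0 ⊗ f (suc n) ⊕ w 1 ⊗ f n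

  act-cong : ∀ {w w′ f f′} → w ≈ₜ w′ → f ≈ₜ f′ → act w f ≈ₜ act w′ f′
  act-cong w≈ f≈ zero    = *-cong (w≈ 0) (f≈ 0)
  act-cong w≈ f≈ (suc n) = +-cong (*-cong (w≈ 0) (f≈ (suc n))) (*-cong (w≈ 1) (f≈ n))

  private
    interchange : ∀ w x y z → (w ⊕ x) ⊕ (y ⊕ z) ≈ (w ⊕ y) ⊕ (x ⊕ z)
    interchange = CommutativeSemigroupProperties.interchange +-commutativeSemigroup

  act-+ : ∀ w f g → act w (f +ₜ g) ≈ₜ act w f +ₜ act w g
  act-+ w f g zero    = distribˡ _ _ _
  act-+ w f g (suc n) = trans (+-cong (distribˡ _ _ _) (distribˡ _ _ _)) (interchange _ _ _ _)

  +-act : ∀ w v f → act (w +ₜ v) f ≈ₜ act w f +ₜ act v f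
  +-act w v f zero    = distribʳ _ _ _
  +-act w v f (suc n) = trans (+-cong (distribʳ _ _ _) (distribʳ _ _ _)) (interchange _ _ _ _)

  act-zero : ∀ {w f} → f ≈ₜ (λ _ → 0#) → act w f ≈ₜ λ _ → 0#
  act-zero f≈0 zero    = ⊗0 (f≈0 0)
  act-zero f≈0 (suc n) = trans (+-cong (⊗0 (f≈0 (suc n))) (⊗0 (f≈0 n))) (+-identityˡ 0#)

  -act : ∀ w f → act (-ₜ w) f ≈ₜ -ₜ act w f
  -act w f zero    = sym (-‿distribˡ-* _ _)
  -act w f (suc n) = trans (+-cong (sym (-‿distribˡ-* _ _)) (sym (-‿distribˡ-* _ _))) (-‿+-comm _ _)

  0ₜ≈0 : ∀ n → 0ₜ n ≈ 0#
  0ₜ≈0 zero    = refl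
  0ₜ≈0 (suc n) = refl

  zero-act : ∀ f → act 0ₜ f ≈ₜ λ _ → 0#
  zero-act f zero    = zeroˡ _
  zero-act f (suc n) = trans (+-cong (zeroˡ _) (zeroˡ _)) (+-identityˡ 0#)

  one-act : ∀ f → act 1ₜ f ≈ₜ f
  one-act f zero    = *-identityˡ _
  one-act f (suc n) = trans (+-cong (*-identityˡ _) (zeroˡ _)) (+-identityʳ _)

  *ₜ-linearˡ : ∀ {w} → Linear w → ∀ f → w *ₜ f ≈ₜ act w f
  *ₜ-linearˡ lin f zero    = +-identityʳ _
  *ₜ-linearˡ lin f (suc n) = +-congˡ (trans (+-congˡ (sum-zero {n} λ i → 0⊗ (lin (toℕ i)))) (+-identityʳ _))

  -- Only the last two summands of the convolution survive. The recursion removes leading summands,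
  -- shifting `f`, until just these two are left.
  *ₜ-linearʳ : ∀ {w} → Linear w → ∀ f → f *ₜ w ≈ₜ act w f
  *ₜ-linearʳ lin f zero = trans (+-identityʳ _) (*-comm _ _)
  *ₜ-linearʳ {w} lin f (suc zero) = trans (+-cong (*-comm _ _) (trans (+-identityʳ _) (*-comm _ _))) (+-comm _ _)
  *ₜ-linearʳ {w} lin f (suc (suc n)) = trans (+-congʳ (⊗0 (lin n))) (trans (+-identityˡ _)
    (*ₜ-linearʳ {w} lin (f ∘ suc) (suc n)))

  sumₜ : ∀ {n} → (Fin n → Series) → Series
  sumₜ = RawSemiringDefs.sum (RawRing.rawSemiring (powerSeries rawRing))

  sumₜ-coefficient : ∀ {N} (f : Fin N → Series) n → sumₜ f n ≈ sum (λ i → f i n)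
  sumₜ-coefficient {zero}  f n = 0ₜ≈0 n
  sumₜ-coefficient {suc N} f n = +-congˡ (sumₜ-coefficient (f ∘ suc) n)

  Matrixₜ : ℕ → Set c
  Matrixₜ n = Fin n → Fin n → Series

  Iₜ : ∀ {n} → Matrixₜ n
  Iₜ {n} = RawRing.1# (matrix (powerSeries rawRing) n)

  Iₜ-diagonal : ∀ {n} (a : Fin n) → Iₜ a a ≡ 1ₜ
  Iₜ-diagonal a with a Fin.≟ a
  ... | yes _  = ≡.refl
  ... | no a≢a = contradiction ≡.refl a≢a

  Iₜ-off : ∀ {n} {b a : Fin n} → b ≢ a → Iₜ b a ≡ 0ₜ
  Iₜ-off {b = b} {a} b≢a with b Fin.≟ a
  ... | yes b≡a = contradiction b≡a b≢a
  ... | no _    = ≡.refl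

  Iₜ-zero : ∀ {n} (b a : Fin n) → Iₜ b a 0 ≡ I b a
  Iₜ-zero b a with b Fin.≟ a
  ... | yes _ = ≡.refl
  ... | no _  = ≡.refl

  Iₜ-suc : ∀ {n} (b a : Fin n) k → Iₜ b a (suc k) ≡ 0#
  Iₜ-suc b a k with b Fin.≟ a
  ... | yes _ = ≡.refl
  ... | no _  = ≡.refl

  -- The inverse of I - T

  module Transfer {N : ℕ} (T : Matrixₜ N) (linear : ∀ b a → Linear (T b a))
                  (lower : StrictlyLower (λ b a → T b a 0)) where
    private
      T₀ T₁ P : Matrix N N
      T₀ b a = T b a 0
      T₁ b a = T b a 1
      P = star T₀

    IsRow : Fin N → (Fin N → Series) → Set ℓ
    IsRow k f = ∀ a n → f a n ≈ Iₜ {N} k a n ⊕ sum (λ b → act (T b a) (f b) n)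

    -- Induction on the power of t: the coefficient of t^(n+1) solves a triangular system for `T₀`
    -- whose inhomogeneous term contains only the coefficient of t^n.
    row-unique : ∀ {k f g} → IsRow k f → IsRow k g → ∀ a → f a ≈ₜ g a
    row-unique {k} {f} {g} f-row g-row a n = go n a
      where
      split : ∀ {h} → IsRow k h → ∀ n a → h a (suc n) ≈
              (Iₜ {N} k a (suc n) ⊕ sum (λ b → T₁ b a ⊗ h b n)) ⊕ sum (λ b → T₀ b a ⊗ h b (suc n))
      split {h} h-row n a = trans (h-row a (suc n)) (trans
        (+-congˡ (trans (∑-distrib-+ {N} (λ b → T₀ b a ⊗ h b (suc n)) (λ b → T₁ b a ⊗ h b n)) (+-comm _ _))) (sym (+-assoc _ _ _)))
      go : ∀ n a → f a n ≈ g a n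
      go zero    = lower-unique T₀ lower (λ a → f-row a 0) (λ a → g-row a 0)
      go (suc n) = lower-unique T₀ lower (split f-row n) λ a → trans (split g-row n a)
        (+-congʳ (+-congˡ (sum-cong-≋ {N} λ b → *-congˡ (sym (go n b)))))

    -- The coefficient P (T₁ P)^n of t^n in (I - T₀ - t T₁)⁻¹, where P = (I - T₀)⁻¹.
    G : ℕ → Matrix N N
    G zero    = P
    G (suc n) = P ∙ (T₁ ∙ G n)

    private
      P-right : ∀ {n} (A : Matrix N n) b a → (P ∙ A) b a ≈ A b a ⊕ (T₀ ∙ (P ∙ A)) b a
      P-right A b a = begin
        sum (λ i → P b i ⊗ A i a)
          ≈⟨ sum-cong-≋ {N} (λ i → trans (*-congʳ (star-right T₀ lower b i)) (distribʳ _ _ _)) ⟩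
        sum (λ i → I b i ⊗ A i a ⊕ (T₀ ∙ P) b i ⊗ A i a)
          ≈⟨ ∑-distrib-+ {N} (λ i → I b i ⊗ A i a) (λ i → (T₀ ∙ P) b i ⊗ A i a) ⟩
        sum (λ i → I b i ⊗ A i a) ⊕ ((T₀ ∙ P) ∙ A) b a
          ≈⟨ +-cong (trans (sum-single {N} b λ i i≢b → 0⊗ (reflexive (I-off (i≢b ∘ ≡.sym))))
                           (trans (*-congʳ (reflexive (I-diagonal b))) (*-identityˡ _)))
                    (∙-assoc T₀ P A b a) ⟩
        A b a ⊕ (T₀ ∙ (P ∙ A)) b a ∎

      P-left : ∀ {n} (A : Matrix n N) b a → (A ∙ P) b a ≈ A b a ⊕ ((A ∙ P) ∙ T₀) b a
      P-left A b a = begin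
        sum (λ i → A b i ⊗ P i a)
          ≈⟨ sum-cong-≋ {N} (λ i → trans (*-congˡ (star-left T₀ lower i a)) (distribˡ _ _ _)) ⟩
        sum (λ i → A b i ⊗ I i a ⊕ A b i ⊗ (P ∙ T₀) i a)
          ≈⟨ ∑-distrib-+ {N} (λ i → A b i ⊗ I i a) (λ i → A b i ⊗ (P ∙ T₀) i a) ⟩
        sum (λ i → A b i ⊗ I i a) ⊕ (A ∙ (P ∙ T₀)) b a
          ≈⟨ +-cong (trans (sum-single {N} a λ i i≢a → ⊗0 (reflexive (I-off i≢a)))
                           (trans (*-congˡ (reflexive (I-diagonal a))) (*-identityʳ _)))
                    (sym (∙-assoc A P T₀ b a)) ⟩
        A b a ⊕ ((A ∙ P) ∙ T₀) b a ∎

    -- Splits P (T₁ P)^(n+1) at its right end. The recursion defining `G` serves the right inverse,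
    -- this one the left inverse and thereby the row equations.
    G-left : ∀ n b a → G (suc n) b a ≈ ((G n ∙ T₁) ∙ P) b a
    G-left zero    b a = sym (∙-assoc P T₁ P b a)
    G-left (suc n) b a = begin
      (P ∙ (T₁ ∙ G (suc n))) b a            ≈⟨ ∙-congˡ P (∙-congˡ T₁ (G-left n)) b a ⟩
      (P ∙ (T₁ ∙ ((G n ∙ T₁) ∙ P))) b a     ≈⟨ ∙-congˡ P (∙-assoc T₁ (G n ∙ T₁) P) b a ⟨
      (P ∙ ((T₁ ∙ (G n ∙ T₁)) ∙ P)) b a     ≈⟨ ∙-congˡ P (∙-congʳ P (∙-assoc T₁ (G n) T₁)) b a ⟨
      (P ∙ (((T₁ ∙ G n) ∙ T₁) ∙ P)) b a     ≈⟨ ∙-assoc P ((T₁ ∙ G n) ∙ T₁) P b a ⟨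
      ((P ∙ ((T₁ ∙ G n) ∙ T₁)) ∙ P) b a     ≈⟨ ∙-congʳ P (∙-assoc P (T₁ ∙ G n) T₁) b a ⟨
      (((P ∙ (T₁ ∙ G n)) ∙ T₁) ∙ P) b a     ∎

    Gₜ : Matrixₜ N
    Gₜ b a n = G n b a

    private
      merge : ∀ b a k (x₀ x₁ : Fin N → Carrier) →
              sum x₁ ⊕ sum x₀ ≈ Iₜ {N} b a (suc k) ⊕ sum (λ i → x₀ i ⊕ x₁ i)
      merge b a k x₀ x₁ = trans (trans (+-comm _ _) (sym (∑-distrib-+ {N} x₀ x₁)))
        (x≈0⊕x (reflexive (Iₜ-suc {N} b a k)))

    Gₜ-right : ∀ b a n → Gₜ b a n ≈ Iₜ {N} b a n ⊕ sum (λ i → act (T b i) (Gₜ i a) n)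
    Gₜ-right b a zero    = trans (star-right T₀ lower b a) (+-congʳ (reflexive (≡.sym (Iₜ-zero {N} b a))))
    Gₜ-right b a (suc n) = trans (P-right (T₁ ∙ G n) b a)
      (merge b a n (λ i → T₀ b i ⊗ G (suc n) i a) (λ i → T₁ b i ⊗ G n i a))

    Gₜ-row : ∀ b → IsRow b (Gₜ b)
    Gₜ-row b a zero    = trans (star-left T₀ lower b a)
      (+-cong (reflexive (≡.sym (Iₜ-zero {N} b a))) (sum-cong-≋ {N} λ i → *-comm _ _))
    Gₜ-row b a (suc n) = begin
      G (suc n) b a
        ≈⟨ G-left n b a ⟩
      ((G n ∙ T₁) ∙ P) b a
        ≈⟨ P-left (G n ∙ T₁) b a ⟩
      (G n ∙ T₁) b a ⊕ (((G n ∙ T₁) ∙ P) ∙ T₀) b a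
        ≈⟨ +-cong (sum-cong-≋ {N} (λ i → *-comm (G n b i) (T₁ i a)))
                  (trans (∙-congʳ T₀ (λ b a → sym (G-left n b a)) b a) (sum-cong-≋ {N} (λ i → *-comm (G (suc n) b i) (T₀ i a)))) ⟩
      sum (λ i → T₁ i a ⊗ G n b i) ⊕ sum (λ i → T₀ i a ⊗ G (suc n) b i)
        ≈⟨ merge b a n (λ i → T₀ i a ⊗ G (suc n) b i) (λ i → T₁ i a ⊗ G n b i) ⟩
      Iₜ {N} b a (suc n) ⊕ sum (λ i → act (T i a) (Gₜ b i) (suc n)) ∎

    open RawRing (matrix (powerSeries rawRing) N) using () renaming
      (_≈_ to _≈ₘ_; _+_ to _+ₘ_; _*_ to _*ₘ_; -_ to -ₘ_)

    private
      M : Matrixₜ N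
      M = Iₜ +ₘ (-ₘ T)

      M-linear : ∀ b a → Linear (M b a)
      M-linear b a n = trans (+-cong (reflexive (Iₜ-suc {N} b a (suc n))) (trans (-‿cong (linear b a n)) -0#≈0#)) (+-identityˡ 0#)

      act-M : ∀ b a f n → act (M b a) f n ≈ act (Iₜ {N} b a) f n ⊕ - act (T b a) f n
      act-M b a f n = trans (+-act (Iₜ {N} b a) (-ₜ T b a) f n) (+-congˡ (-act (T b a) f n))

      cancel : ∀ {x y z} → x ≈ y ⊕ z → x ⊕ - z ≈ y
      cancel x≈y+z = trans (+-congʳ x≈y+z) (trans (+-assoc _ _ _) (trans (+-congˡ (-‿inverseʳ _)) (+-identityʳ _)))

      act-I-off : ∀ {b a} → b ≢ a → ∀ f n → act (Iₜ {N} b a) f n ≈ 0#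
      act-I-off b≢a f n = trans (reflexive (≡.cong (λ w → act w f n) (Iₜ-off {N} b≢a))) (zero-act f n)

      act-I-diagonal : ∀ a f n → act (Iₜ {N} a a) f n ≈ f n
      act-I-diagonal a f n = trans (reflexive (≡.cong (λ w → act w f n) (Iₜ-diagonal {N} a))) (one-act f n)

    left-inverse : Gₜ *ₘ M ≈ₘ Iₜ
    left-inverse b a n = begin
      (Gₜ *ₘ M) b a n
        ≈⟨ sumₜ-coefficient {N} (λ i → Gₜ b i *ₜ M i a) n ⟩
      sum (λ i → (Gₜ b i *ₜ M i a) n)
        ≈⟨ sum-cong-≋ {N} (λ i → trans (*ₜ-linearʳ (M-linear i a) (Gₜ b i) n) (act-M i a (Gₜ b i) n)) ⟩
      sum (λ i → act (Iₜ {N} i a) (Gₜ b i) n ⊕ - act (T i a) (Gₜ b i) n)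
        ≈⟨ ∑-distrib-+ {N} (λ i → act (Iₜ {N} i a) (Gₜ b i) n) (λ i → - act (T i a) (Gₜ b i) n) ⟩
      sum (λ i → act (Iₜ {N} i a) (Gₜ b i) n) ⊕ sum (λ i → - act (T i a) (Gₜ b i) n)
        ≈⟨ +-cong (trans (sum-single {N} {λ i → act (Iₜ {N} i a) (Gₜ b i) n} a (λ i i≢a → act-I-off {i} {a} i≢a (Gₜ b i) n)) (act-I-diagonal a (Gₜ b a) n))
                  (sum-⊖ (λ i → act (T i a) (Gₜ b i) n)) ⟩
      Gₜ b a n ⊕ - sum (λ i → act (T i a) (Gₜ b i) n)
        ≈⟨ cancel (Gₜ-row b a n) ⟩
      Iₜ {N} b a n ∎

    right-inverse : M *ₘ Gₜ ≈ₘ Iₜ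
    right-inverse b a n = begin
      (M *ₘ Gₜ) b a n
        ≈⟨ sumₜ-coefficient {N} (λ i → M b i *ₜ Gₜ i a) n ⟩
      sum (λ i → (M b i *ₜ Gₜ i a) n)
        ≈⟨ sum-cong-≋ {N} (λ i → trans (*ₜ-linearˡ (M-linear b i) (Gₜ i a) n) (act-M b i (Gₜ i a) n)) ⟩
      sum (λ i → act (Iₜ {N} b i) (Gₜ i a) n ⊕ - act (T b i) (Gₜ i a) n)
        ≈⟨ ∑-distrib-+ {N} (λ i → act (Iₜ {N} b i) (Gₜ i a) n) (λ i → - act (T b i) (Gₜ i a) n) ⟩
      sum (λ i → act (Iₜ {N} b i) (Gₜ i a) n) ⊕ sum (λ i → - act (T b i) (Gₜ i a) n)
        ≈⟨ +-cong (trans (sum-single {N} {λ i → act (Iₜ {N} b i) (Gₜ i a) n} b (λ i i≢b → act-I-off {b} {i} (i≢b ∘ ≡.sym) (Gₜ i a) n)) (act-I-diagonal b (Gₜ b a) n))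
                  (sum-⊖ (λ i → act (T b i) (Gₜ i a) n)) ⟩
      Gₜ b a n ⊕ - sum (λ i → act (T b i) (Gₜ i a) n)
        ≈⟨ cancel (Gₜ-right b a n) ⟩
      Iₜ {N} b a n ∎

    resolvent : Invertible _≈ₘ_ Iₜ _*ₘ_ (Iₜ +ₘ (-ₘ T))
    resolvent = Gₜ , left-inverse , right-inverse

-- The strings of a Motzkin path

-- Strings ascent o n ss: the segments ss partition o+1, …, o+n, and i, i+1
-- never lie in the same segment if ascent i holds.
data Strings (ascent : ℕ → Bool) : ℕ → ℕ → List Segment → Set where
  []  : ∀ {o} → Strings ascent o 0 []
  _∷_ : ∀ {o k n ss} → (∀ q → q < k → ascent (suc (o + q)) ≡ false) →
        Strings ascent (o + suc k) n ss → Strings ascent o (suc k + n) (segment o (suc k) ∷ ss)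

restart : ∀ {ascent o o′ n ss} → o ≡ o′ → Strings ascent o n ss → Strings ascent o′ n ss
restart ≡.refl strings = strings

-- With `ascent` constantly false the condition is trivial and only the partition into segments is
-- asserted; the ascending segments are treated in this way.
segmentsFrom-strings : ∀ ε {ascent n} o (xs : Vec ℤ n) →
  (∀ i → xs ⟨ suc (suc i) ⟩ ≡ xs ⟨ suc i ⟩ ℤ.+ ε → ascent (suc (o + i)) ≡ false) →
  Strings ascent o n (segmentsFrom ε o (toList xs))
segmentsFrom-strings ε o []           inner = []
segmentsFrom-strings ε o (x ∷ [])     inner = (λ _ ()) ∷ []
segmentsFrom-strings ε {ascent} o (x ∷ y ∷ xs) inner
  with y ℤ.≟ x ℤ.+ ε
     | segmentsFrom-strings ε (suc o) (y ∷ xs) (λ i eq → ≡.trans (≡.cong (ascent ∘ suc) (≡.sym (ℕ.+-suc o i))) (inner (suc i) eq))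
... | no _   | rest = (λ _ ()) ∷ restart (≡.sym (ℕ.+-comm o 1)) rest
... | yes y≡ | rest = prepend rest
  where
  prepend : ∀ {n ss} → Strings ascent (suc o) (suc n) ss → Strings ascent o (suc (suc n)) (extend ss)
  prepend (_∷_ {k = k} inner′ rest) =
    (λ { zero _ → inner 0 y≡
       ; (suc q) (s≤s q<k) → ≡.trans (≡.cong (ascent ∘ suc) (ℕ.+-suc o q)) (inner′ q q<k) })
    ∷ restart (≡.sym (ℕ.+-suc o (suc k))) rest

⟨⟩-beyond : ∀ {n} (xs : Vec ℤ n) {i} → n < i → xs ⟨ i ⟩ ≡ 0ℤ
⟨⟩-beyond []       n<i             = ≡.refl
⟨⟩-beyond (x ∷ xs) {suc (suc i)} (s≤s n<i) = ⟨⟩-beyond xs n<i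

module Ascents {r : ℕ} (m : Vec ℤ r) where

  -- ascent i compares m_i with m_{i+1}.  The vertex 1 of Γ_m fits the
  -- numbering of the vertices beyond an ascent, hence ascent 0.  The
  -- junk value of ascent r is harmless: only zero terms depend on it.
  ascent : ℕ → Bool
  ascent zero      = true
  ascent i@(suc _) = ⌊ m ⟨ suc i ⟩ ℤ.≟ m ⟨ i ⟩ ℤ.+ 1ℤ ⌋

  descent⇒¬ascent : ∀ i → m ⟨ suc (suc i) ⟩ ≡ m ⟨ suc i ⟩ ℤ.+ -1ℤ → ascent (suc i) ≡ false
  descent⇒¬ascent i down with m ⟨ suc (suc i) ⟩ ℤ.≟ m ⟨ suc i ⟩ ℤ.+ 1ℤ
  ... | no _   = ≡.refl
  ... | yes up = contradiction (∙-cancelˡ (m ⟨ suc i ⟩) -1ℤ 1ℤ (≡.trans (≡.sym down) up)) λ ()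
    where open AbelianGroupProperties ℤ.+-0-abelianGroup using (∙-cancelˡ)

  descending-strings : Strings ascent 0 r (descending m)
  descending-strings = segmentsFrom-strings -1ℤ 0 m descent⇒¬ascent

  -- The vertex of Γ_m that corresponds to the vertex i+1 of Γ′_m.  At an
  -- ascent the latter comes from the two vertices 2i and 2i+1; this is
  -- the one which belongs to the second of the two strings.
  vertex : ℕ → ℕ
  vertex i = if ascent i then suc (2 * i) else 2 * i

  vertex-true : ∀ i → ascent i ≡ true → vertex i ≡ suc (2 * i)
  vertex-true i eq rewrite eq = ≡.refl

  vertex-false : ∀ i → ascent i ≡ false → vertex i ≡ 2 * i
  vertex-false i eq rewrite eq = ≡.refl

-- The edges of Γ independently of the gluing

module Regroup {c ℓ₁ ℓ₂ : Level} (F : HeytingField c ℓ₁ ℓ₂) {r : ℕ} (m : Vec ℤ r)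
               (y : Label → FieldDefs.NonzeroElement F) where
  open FieldDefs F
  open Graphs m y
  open Ascents m

  -- The skeleton edges with labels 2(i+1) and 2i+1. An odd edge always joins 2i and 2i+1, be it the
  -- root edge, an edge (j,j′) or the last edge of a string; the gluing affects only the near ends
  -- of even edges.
  evenEdges oddEdges : ℕ → List Edge
  evenEdges i = orient (treeEdge (vertex i) (2 * suc i) (even (suc i)))
  oddEdges  i = orient (treeEdge (2 * i) (suc (2 * i)) (odd (suc i)))

  descents : Segment → List Edge
  descents (segment o k) =
    concatMap (λ p → List.map (λ q → edge (suc o + p) (suc o + q) (t* redundant (suc o + q) (suc o + p)))
                              (range 0 (p ∸ 2)))
              (range 2 k)

  descent-edge : ℕ → ℕ → ℕ → Edge
  descent-edge o i q = edge (suc o + (2 + i)) (suc o + q) (t* redundant (suc o + q) (suc o + (2 + i)))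

  descents-block : ∀ o k → descents (segment o (suc k)) ≡ block (λ i → applyUpTo (descent-edge o i) (suc i)) k
  descents-block o k = ≡.trans
    (concatMap-range (λ p → List.map (λ q → edge (suc o + p) (suc o + q) (t* redundant (suc o + q) (suc o + p)))
                                     (range 0 (p ∸ 2))) 2 (suc k))
    (block-cong k λ i _ → map-range _ 0 i)

  -- The source of an additional edge is not the first vertex of its string, hence an even vertex,
  -- even if m ascends there: the odd copy then belongs to the next string. The target is the copy
  -- in its own string, which `vertex` selects.
  relocate : Edge → Edge
  relocate (edge s t w) = edge (2 * pred s) (vertex (pred t)) w

  module _ (v₀ v₁ o k : ℕ) (v₁≡ : v₁ ≡ vertex o) (inner : ∀ q → q < k → ascent (suc (o + q)) ≡ false) where
    private
      φ : Vertex → ℕ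
      φ = place v₀ v₁ (segment o (suc k))

    place-far : ∀ i → i < suc k → φ (spine (suc (suc i))) ≡ 2 * (o + suc i)
    place-far i i<1+k rewrite ≡ᵇ-false (ℕ.<⇒≢ i<1+k) = ≡.refl

    -- Beyond the first edge, the near end is the far end of the preceding even edge; as a string
    -- contains no ascent, `vertex` gives that even number.
    place-near : ∀ i → i < suc k → φ (spine (suc i)) ≡ vertex (o + i)
    place-near zero    _ = ≡.trans v₁≡ (≡.cong vertex (≡.sym (ℕ.+-identityʳ o)))
    place-near (suc i) (s≤s i<k) = ≡.trans (place-far i (ℕ.m<n⇒m<1+n i<k)) (≡.sym (vertex-false (o + suc i)
      (≡.trans (≡.cong ascent (ℕ.+-suc o i)) (inner i i<k))))

    place-last : φ (spine (suc (suc (suc k)))) ≡ suc (2 * (o + suc k))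
    place-last rewrite ≡ᵇ-refl k = ≡.refl

    skeleton-edges : TreeEdge Vertex → List Edge
    skeleton-edges (treeEdge near far j) = orient (treeEdge (φ near) (φ far) (j +2· o))

    orient-cong : ∀ {n n′ f f′ j j′} → n ≡ n′ → f ≡ f′ → j ≡ j′ → orient (treeEdge n f j) ≡ orient (treeEdge n′ f′ j′)
    orient-cong ≡.refl ≡.refl ≡.refl = ≡.refl

    even-branches : concatMap skeleton-edges (List.map (λ j → treeEdge (spine j) (spine (suc j)) (even j)) (range 1 (suc k)))
                    ≡ block (λ i → evenEdges (o + i)) (suc k)
    even-branches = ≡.trans (concatMap-map-range skeleton-edges _ 1 (suc k)) (block-cong (suc k) λ i i<1+k →
      orient-cong (place-near i i<1+k) (≡.trans (place-far i i<1+k) (≡.cong (2 *_) (ℕ.+-suc o i))) (≡.cong even (ℕ.+-suc o i)))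

    -- The last edge (k+1,k+2) is numbered just like the edges (j,j′), so it completes their block.
    odd-branches : concatMap skeleton-edges
                     (List.map (λ j → treeEdge (spine j) (prime j) (odd j)) (range 2 (suc k)) ++
                      [ treeEdge (spine (suc k + 1)) (spine (suc k + 2)) (odd (suc k + 1)) ])
                   ≡ block (λ i → oddEdges (o + suc i)) (suc k)
    odd-branches rewrite ℕ.+-comm k 1 | ℕ.+-comm k 2 = ≡.trans
      (List.concatMap-++ skeleton-edges (List.map (λ j → treeEdge (spine j) (prime j) (odd j)) (range 2 (suc k))) _)
      (≡.trans
        (≡.cong₂ _++_
          (≡.trans (concatMap-map-range skeleton-edges _ 2 (suc k)) (block-cong k λ i i<k →
            orient-cong (place-far i (ℕ.m<n⇒m<1+n i<k)) (prime≡ i) (≡.cong odd (ℕ.+-suc o (suc i)))))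
          (orient-cong (place-far k ℕ.≤-refl) place-last (≡.cong odd (ℕ.+-suc o (suc k)))))
        (block-∷ʳ (λ i → oddEdges (o + suc i)) k))
      where
      prime≡ : ∀ i → pred (2 * (o + suc (suc i))) ≡ suc (2 * (o + suc i))
      prime≡ i = ≡.trans (≡.cong (λ j → pred (2 * j)) (ℕ.+-suc o (suc i))) (ℕ.+-suc (o + suc i) _)

    additional-edges : concatMap (λ a → List.map (λ b → edge (φ (spine a)) (φ (spine b)) (t* redundant (o + b) (o + a)))
                                                 (range 1 (a ∸ 2)))
                                 (range 3 (suc k + 1))
                       ≡ List.map relocate (descents (segment o (suc k)))
    additional-edges rewrite ℕ.+-comm k 1 = ≡.trans
      (concatMap-range (λ a → List.map (λ b → edge (φ (spine a)) (φ (spine b)) (t* redundant (o + b) (o + a)))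
                                       (range 1 (a ∸ 2))) 3 (suc (suc k)))
      (≡.trans
        (block-cong k λ i i<k → ≡.trans
          (map-range _ 1 (suc i))
          (≡.trans (applyUpTo-cong (suc i) λ q q<1+i → edge-cong
                   (place-far (suc i) (s≤s i<k))
                   (place-near q (ℕ.m<n⇒m<1+n (ℕ.<-≤-trans q<1+i i<k)))
                   (ℕ.+-suc o q) (ℕ.+-suc o (suc (suc i))))
                 (≡.sym (List.map-applyUpTo (descent-edge o i) relocate (suc i)))))
        (≡.sym (≡.trans (≡.cong (List.map relocate) (descents-block o k)) (map-block relocate _ k))))
      where
      edge-cong : ∀ {s s′ t t′ b b′ a a′} → s ≡ s′ → t ≡ t′ → b ≡ b′ → a ≡ a′ →
                  edge s t (t* redundant b a) ≡ edge s′ t′ (t* redundant b′ a′)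
      edge-cong ≡.refl ≡.refl ≡.refl ≡.refl = ≡.refl

    piece-edges : piece v₀ v₁ (segment o (suc k)) ≡
      (block (λ i → evenEdges (o + i)) (suc k) ++ block (λ i → oddEdges (o + suc i)) (suc k)) ++
      List.map relocate (descents (segment o (suc k)))
    piece-edges = ≡.cong₂ _++_
      (≡.trans (List.concatMap-++ skeleton-edges (List.map (λ j → treeEdge (spine j) (spine (suc j)) (even j)) (range 1 (suc k))) _)
             (≡.cong₂ _++_ even-branches odd-branches))
      additional-edges

  private
    regroup : ∀ (A₁ A₂ A₃ B₁ B₂ B₃ : List Edge) →
              ((A₁ ++ A₂) ++ A₃) ++ (B₁ ++ (B₂ ++ B₃)) ↭ (A₁ ++ B₁) ++ ((A₂ ++ B₂) ++ (A₃ ++ B₃))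
    regroup = solve 6 (λ a₁ a₂ a₃ b₁ b₂ b₃ →
      ((a₁ ⊕ a₂) ⊕ a₃) ⊕ (b₁ ⊕ (b₂ ⊕ b₃)) ⊜ (a₁ ⊕ b₁) ⊕ ((a₂ ⊕ b₂) ⊕ (a₃ ⊕ b₃))) ↭-refl
      where open CommutativeMonoidSolver (++-commutativeMonoid {A = Edge})

  -- The invariant is the number of vertex 1 of the next string. Both gluing rules preserve it: this
  -- vertex is 2(o+k+1)+1 after an ascent and 2(o+k+1) after a flat step. Vertex 0 lies only on the
  -- edge (0,1), which is listed with the preceding string.
  glue-↭ : ∀ {o n ss} → Strings ascent o n ss → ∀ v₀ v₁ → v₁ ≡ vertex o →
           glue v₀ v₁ ss ↭ block (λ i → evenEdges (o + i)) n ++ (block (λ i → oddEdges (o + suc i)) n ++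
                           List.map relocate (concatMap descents ss))
  glue-↭ []                                               v₀ v₁ v₁≡ = ↭-refl
  glue-↭ (_∷_ {o} {k} {n} {ss} inner strings) v₀ v₁ v₁≡ = ↭-trans
    (↭-trans
      (++⁺ˡ (piece v₀ v₁ (segment o (suc k))) next)
      (↭-reflexive (≡.cong (_++ rest) (piece-edges v₀ v₁ o k v₁≡ inner))))
    (↭-trans
      (regroup (block (λ i → evenEdges (o + i)) (suc k)) _ _ (block (λ i → evenEdges (o + suc k + i)) n) _ _)
      (↭-reflexive (≡.cong₂ _++_ evens (≡.cong₂ _++_ odds (≡.sym (List.map-++ relocate (descents (segment o (suc k))) _))))))
    where
    φ : Vertex → ℕ
    φ = place v₀ v₁ (segment o (suc k))
    rest : List Edge
    rest = block (λ i → evenEdges (o + suc k + i)) n ++ (block (λ i → oddEdges (o + suc k + suc i)) n ++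
           List.map relocate (concatMap descents ss))
    evens : block (λ i → evenEdges (o + i)) (suc k) ++ block (λ i → evenEdges (o + suc k + i)) n ≡
            block (λ i → evenEdges (o + i)) (suc k + n)
    evens = ≡.trans (≡.cong (block (λ i → evenEdges (o + i)) (suc k) ++_)
                    (block-cong n λ i _ → ≡.cong evenEdges (ℕ.+-assoc o (suc k) i)))
                  (≡.sym (block-+ (λ i → evenEdges (o + i)) (suc k) n))
    odds : block (λ i → oddEdges (o + suc i)) (suc k) ++ block (λ i → oddEdges (o + suc k + suc i)) n ≡
           block (λ i → oddEdges (o + suc i)) (suc k + n)
    odds = ≡.trans (≡.cong (block (λ i → oddEdges (o + suc i)) (suc k) ++_)
                   (block-cong n λ i _ → ≡.cong oddEdges (≡.trans (ℕ.+-assoc o (suc k) (suc i)) (≡.cong (λ j → o + suc j) (ℕ.+-suc k i)))))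
                 (≡.sym (block-+ (λ i → oddEdges (o + suc i)) (suc k) n))
    φ-last φ-penultimate : ℕ
    φ-last        = φ (spine (suc k + 2))
    φ-penultimate = φ (spine (suc k + 1))
    φ-last≡ : φ-last ≡ suc (2 * (o + suc k))
    φ-last≡ = ≡.trans (≡.cong (φ ∘ spine) (ℕ.+-comm (suc k) 2)) (place-last v₀ v₁ o k v₁≡ inner)
    φ-penultimate≡ : φ-penultimate ≡ 2 * (o + suc k)
    φ-penultimate≡ = ≡.trans (≡.cong (φ ∘ spine) (ℕ.+-comm (suc k) 1)) (place-far v₀ v₁ o k v₁≡ inner k ℕ.≤-refl)
    -- `ascent` computes only on a visible successor.
    ascent-end : ascent (o + suc k) ≡ ⌊ m ⟨ suc (o + suc k) ⟩ ℤ.≟ m ⟨ o + suc k ⟩ ℤ.+ 1ℤ ⌋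
    ascent-end rewrite ℕ.+-suc o k = ≡.refl
    next : (if ⌊ m ⟨ suc (o + suc k) ⟩ ℤ.≟ m ⟨ o + suc k ⟩ ℤ.+ 1ℤ ⌋
            then glue φ-penultimate φ-last ss else glue φ-last φ-penultimate ss) ↭ rest
    next with ⌊ m ⟨ suc (o + suc k) ⟩ ℤ.≟ m ⟨ o + suc k ⟩ ℤ.+ 1ℤ ⌋ in eq
    ... | true  = glue-↭ strings _ _ (≡.trans φ-last≡ (≡.sym (vertex-true (o + suc k) (≡.trans ascent-end eq))))
    ... | false = glue-↭ strings _ _ (≡.trans φ-penultimate≡ (≡.sym (vertex-false (o + suc k) (≡.trans ascent-end eq))))

  Γ-↭ : Γ ↭ block evenEdges r ++ (block oddEdges (suc r) ++ List.map relocate (concatMap descents (descending m)))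
  Γ-↭ = ↭-trans (++⁺ˡ (oddEdges 0) (glue-↭ descending-strings 0 1 ≡.refl))
    (solve 4 (λ x e o d → x ⊕ (e ⊕ (o ⊕ d)) ⊜ e ⊕ ((x ⊕ o) ⊕ d)) ↭-refl
      (oddEdges 0) (block evenEdges r) (block (oddEdges ∘ suc) r) _)
    where open CommutativeMonoidSolver (++-commutativeMonoid {A = Edge})

-- Rows of transfer matrices

module RowEquations {c ℓ₁ ℓ₂ : Level} (F : HeytingField c ℓ₁ ℓ₂) where
  open HeytingField F using (heytingCommutativeRing)
  open FieldDefs F
  open Edge

  R : CommutativeRing c ℓ₁
  R = HeytingCommutativeRing.commutativeRing heytingCommutativeRing

  module R = CommutativeRing R
  open R using (Carrier; _≈_; 0#; 1#; -_)
  open LinearAlgebra R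
  open SemiringSum R.semiring using (sum; sum-cong-≋; ∑-distrib-+)

  series : AbelianGroup c ℓ₁
  series = Pointwise.abelianGroup ℕ R.+-abelianGroup

  module S = AbelianGroup series
  open S using () renaming (_∙_ to infixl 6 _⊞_; ε to 0ˢ; _≈_ to infix 4 _≋_; _⁻¹ to infix 8 ⊟_)

  term : (ℕ → Series) → Edge → ℕ → Series
  term Z e a = if source e ≡ᵇ a then act (weight e) (Z (target e)) else 0ˢ

  -- The entry a of Z T, where the row vector Z has its entries indexed
  -- by the numbers of the vertices.
  out : (ℕ → Series) → List Edge → ℕ → Series
  out Z es a = foldr (λ e s → term Z e a ⊞ s) 0ˢ es

  out-++ : ∀ Z es es′ a → out Z (es ++ es′) a ≋ out Z es a ⊞ out Z es′ a
  out-++ Z []       es′ a = S.sym (S.identityˡ _)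
  out-++ Z (e ∷ es) es′ a = S.trans (S.∙-congˡ (out-++ Z es es′ a)) (S.sym (S.assoc _ _ _))

  out-↭ : ∀ Z {es es′} a → es ↭ es′ → out Z es a ≋ out Z es′ a
  out-↭ Z a ↭.refl             = S.refl
  out-↭ Z a (↭.prep e p)       = S.∙-congˡ (out-↭ Z a p)
  out-↭ Z a (↭.swap e e′ p)    = S.trans (S.∙-congˡ (S.∙-congˡ (out-↭ Z a p)))
    (CommutativeSemigroupProperties.x∙yz≈y∙xz S.commutativeSemigroup _ _ _)
  out-↭ Z a (↭.trans p q)      = S.trans (out-↭ Z a p) (out-↭ Z a q)

  -- The condition on single edges from which both hypotheses of `Transfer` follow. A walk of
  -- bounded degree in t then has bounded length.
  record Admissible (e : Edge) : Set ℓ₁ where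
    constructor admissible
    field
      linear : Linear (weight e)
      rising : source e < target e ⊎ weight e 0 ≈ 0#

  module _ {N : ℕ} (o : ℕ) where
    private
      number : Fin N → ℕ
      number i = o + toℕ i

    -- Since `f` vanishes off the vertex numbers, no separate check is required that the target `x`
    -- of an edge is a vertex.
    sum-number : ∀ (f : ℕ → Series) → (∀ x → x < o → f x ≋ 0ˢ) → (∀ x → o + N ≤ x → f x ≋ 0ˢ) →
                 ∀ x n → sum (λ b → (if x ≡ᵇ number b then f (number b) else 0ˢ) n) ≈ f x n
    sum-number f below above x n with x ℕ.<? o
    ... | yes x<o = R.trans (sum-zero zeros) (R.sym (below x x<o n))
      where
      zeros : ∀ b → (if x ≡ᵇ number b then f (number b) else 0ˢ) n ≈ 0#
      zeros b rewrite ≡ᵇ-false {x} {number b} (λ { ≡.refl → ℕ.<⇒≱ x<o (ℕ.m≤m+n o (toℕ b)) }) = R.refl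
    ... | no x≮o with x ℕ.<? o + N
    ...   | no x≮o+N = R.trans (sum-zero zeros) (R.sym (above x (ℕ.≮⇒≥ x≮o+N) n))
      where
      zeros : ∀ b → (if x ≡ᵇ number b then f (number b) else 0ˢ) n ≈ 0#
      zeros b rewrite ≡ᵇ-false {x} {number b} (λ { ≡.refl → x≮o+N (ℕ.+-monoʳ-< o (Fin.toℕ<n b)) }) = R.refl
    ...   | yes x<o+N = R.trans (sum-single k zeros) (R.reflexive hit)
      where
      x∸o<N : x ℕ.∸ o < N
      x∸o<N = ≡.subst (x ℕ.∸ o <_) (ℕ.m+n∸m≡n o N) (ℕ.∸-monoˡ-< x<o+N (ℕ.≮⇒≥ x≮o))
      k : Fin N
      k = fromℕ< x∸o<N
      number-k : number k ≡ x
      number-k = ≡.trans (≡.cong (o +_) (Fin.toℕ-fromℕ< x∸o<N)) (ℕ.m+[n∸m]≡n (ℕ.≮⇒≥ x≮o))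
      zeros : ∀ b → b ≢ k → (if x ≡ᵇ number b then f (number b) else 0ˢ) n ≈ 0#
      zeros b b≢k rewrite ≡ᵇ-false {x} {number b} (λ x≡ → b≢k (Fin.toℕ-injective
        (ℕ.+-cancelˡ-≡ o (toℕ b) (toℕ k) (≡.sym (≡.trans number-k x≡))))) = R.refl
      hit : (if x ≡ᵇ number k then f (number k) else 0ˢ) n ≡ f x n
      hit rewrite number-k | ≡ᵇ-refl x = ≡.refl

    transferMatrix-∷ : ∀ e es b a → transferMatrix number (e ∷ es) b a ≋
      (if (source e ≡ᵇ number a) ∧ (target e ≡ᵇ number b) then weight e else 0ˢ) ⊞ transferMatrix number es b a
    transferMatrix-∷ e es b a with (source e ≡ᵇ number a) ∧ (target e ≡ᵇ number b)
    ... | true  = S.refl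
    ... | false = S.sym (S.identityˡ _)

    -- Trades the matrix for its list of edges, which may then be permuted and split.
    row-sum : ∀ Z → (∀ x → x < o → Z x ≋ 0ˢ) → (∀ x → o + N ≤ x → Z x ≋ 0ˢ) → ∀ es a n →
              sum (λ b → act (transferMatrix number es b a) (Z (number b)) n) ≈ out Z es (number a) n
    row-sum Z below above []       a n = sum-zero {N} λ b → zero-act (Z (number b)) n
    row-sum Z below above (e ∷ es) a n = R.trans
      (sum-cong-≋ {N} λ b → R.trans
        (act-cong (transferMatrix-∷ e es b a) S.refl n)
        (+-act (entry b) (transferMatrix number es b a) (Z (number b)) n))
      (R.trans
        (∑-distrib-+ {N} (λ b → act (entry b) (Z (number b)) n) (λ b → act (transferMatrix number es b a) (Z (number b)) n))
        (R.+-cong head (row-sum Z below above es a n)))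
      where
      entry : Fin N → Series
      entry b = if (source e ≡ᵇ number a) ∧ (target e ≡ᵇ number b) then weight e else 0ˢ
      zero-act′ : ∀ f → act 0ˢ f ≋ 0ˢ
      zero-act′ f = S.trans (act-cong {f = f} (S.sym 0ₜ≈0) S.refl) (zero-act f)
      head : sum (λ b → act (entry b) (Z (number b)) n) ≈ term Z e (number a) n
      head with source e ≡ᵇ number a
      ... | false = sum-zero {N} λ b → zero-act′ (Z (number b)) n
      ... | true  = R.trans (sum-cong-≋ {N} select)
        (sum-number (λ x → act (weight e) (Z x)) (λ x x< → act-zero (below x x<)) (λ x x≥ → act-zero (above x x≥)) (target e) n)
        where
        select : ∀ b → act (if target e ≡ᵇ number b then weight e else 0ˢ) (Z (number b)) n ≈
                       (if target e ≡ᵇ number b then act (weight e) (Z (number b)) else 0ˢ) n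
        select b with target e ≡ᵇ number b
        ... | true  = R.refl
        ... | false = zero-act′ (Z (number b)) n

    transfer-linear : ∀ {es} → All Admissible es → ∀ b a → Linear (transferMatrix number es b a)
    transfer-linear []                       b a n = R.refl
    transfer-linear {e ∷ es} (admissible lin _ ∷ p) b a n
      with (source e ≡ᵇ number a) ∧ (target e ≡ᵇ number b)
    ... | true  = R.trans (R.+-cong (lin n) (transfer-linear p b a n)) (R.+-identityˡ 0#)
    ... | false = transfer-linear p b a n

    transfer-lower : ∀ {es} → All Admissible es → StrictlyLower (λ b a → transferMatrix number es b a 0)
    transfer-lower []                          b a b≤a = R.refl
    transfer-lower {e ∷ es} (admissible _ up ∷ p) b a b≤a
      with source e ≡ᵇ number a in source≡ | target e ≡ᵇ number b in target≡
    ... | false | _     = transfer-lower p b a b≤a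
    ... | true  | false = transfer-lower p b a b≤a
    ... | true  | true  = R.trans (R.+-cong (weight≈0 up) (transfer-lower p b a b≤a)) (R.+-identityˡ 0#)
      where
      weight≈0 : source e < target e ⊎ weight e 0 ≈ 0# → weight e 0 ≈ 0#
      weight≈0 (inj₁ s<t) = contradiction
        (ℕ.+-monoʳ-≤ o b≤a)
        (ℕ.<⇒≱ (≡.subst₂ _<_ (≡ᵇ-true source≡) (≡ᵇ-true target≡) s<t))
      weight≈0 (inj₂ ≈0)  = ≈0

-- The ascending segments

module AscentEdges {c ℓ₁ ℓ₂ : Level} (F : HeytingField c ℓ₁ ℓ₂) where
  open FieldDefs F
  open Edge
  open RowEquations F
  open R using (Carrier; _≈_; 0#; 1#; -_)
  open LinearAlgebra R
  open S using () renaming (_∙_ to infixl 6 _⊞_; ε to 0ˢ; _≈_ to infix 4 _≋_; _⁻¹ to infix 8 ⊟_)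
  open AbelianGroupProperties series using (ε⁻¹≈ε; ⁻¹-∙-comm)
  open RawSemiringDefs (RawRing.rawSemiring rawRing) using (_^_)
  open SetoidReasoning S.setoid

  sumTo : (ℕ → Series) → ℕ → Series
  sumTo f zero    = 0ˢ
  sumTo f (suc n) = f 0 ⊞ sumTo (f ∘ suc) n

  sumTo-cong : ∀ {f g} n → (∀ i → f i ≋ g i) → sumTo f n ≋ sumTo g n
  sumTo-cong zero    f≋g = S.refl
  sumTo-cong (suc n) f≋g = S.∙-cong (f≋g 0) (sumTo-cong n (f≋g ∘ suc))

  sumTo-zero : ∀ {f} n → (∀ i → i < n → f i ≋ 0ˢ) → sumTo f n ≋ 0ˢ
  sumTo-zero zero    f≋0 = S.refl
  sumTo-zero (suc n) f≋0 = S.trans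
    (S.∙-cong (f≋0 0 (s≤s z≤n)) (sumTo-zero n λ i i<n → f≋0 (suc i) (s≤s i<n))) (S.identityˡ 0ˢ)

  sumTo-⊟ : ∀ f n → sumTo (λ i → ⊟ f i) n ≋ ⊟ sumTo f n
  sumTo-⊟ f zero    = S.sym ε⁻¹≈ε
  sumTo-⊟ f (suc n) = S.trans (S.∙-congˡ (sumTo-⊟ (f ∘ suc) n)) (⁻¹-∙-comm (f 0) (sumTo (f ∘ suc) n))

  out-applyUpTo : ∀ Z e n a → out Z (applyUpTo e n) a ≋ sumTo (λ i → term Z (e i) a) n
  out-applyUpTo Z e zero    a = S.refl
  out-applyUpTo Z e (suc n) a = S.∙-congˡ (out-applyUpTo Z (e ∘ suc) n a)

  out-block : ∀ Z es n a → out Z (block es n) a ≋ sumTo (λ i → out Z (es i) a) n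
  out-block Z es zero    a = S.refl
  out-block Z es (suc n) a = S.trans (out-++ Z (es 0) (block (es ∘ suc) n) a) (S.∙-congˡ (out-block Z (es ∘ suc) n a))

  term-hit : ∀ Z e {a} → source e ≡ a → term Z e a ≋ act (weight e) (Z (target e))
  term-hit Z e {a} ≡.refl rewrite ≡ᵇ-refl a = S.refl

  term-miss : ∀ Z e {a} → source e ≢ a → term Z e a ≋ 0ˢ
  term-miss Z e {a} s≢a rewrite ≡ᵇ-false s≢a = S.refl

  ascent-edge : ℕ → ℕ → ℕ → Edge
  ascent-edge o p q = edge (suc o + q) (suc o + p) (constant rawRing ((- 1#) ^ (p ∸ q ∸ 1)))

  ascents : Segment → List Edge
  ascents (segment o k) = concatMap (λ p → List.map (ascent-edge o p) (range 0 (p ∸ 2))) (range 2 k)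

  ascents-block : ∀ o k → ascents (segment o (suc k)) ≡ block (λ i → applyUpTo (ascent-edge o (2 + i)) (suc i)) k
  ascents-block o k = ≡.trans
    (concatMap-range (λ p → List.map (ascent-edge o p) (range 0 (p ∸ 2))) 2 (suc k))
    (block-cong k λ i _ → map-range (ascent-edge o (2 + i)) 0 i)

  -- The sign of an edge depends only on p - q, so the edges avoiding the first vertex are those of
  -- the shortened segment.
  ascents-suc : ∀ o k → ascents (segment o (suc (suc k))) ↭
                applyUpTo (λ i → ascent-edge o (2 + i) 0) (suc k) ++ ascents (segment (suc o) (suc k))
  ascents-suc o k = ↭-trans
    (↭-reflexive (ascents-block o (suc k)))
    (↭-trans
      (block-∷-↭ (λ i → ascent-edge o (2 + i) 0) (λ i → applyUpTo (ascent-edge o (2 + i) ∘ suc) i) (suc k))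
      (++⁺ˡ (applyUpTo (λ i → ascent-edge o (2 + i) 0) (suc k)) (↭-reflexive (≡.trans
        (block-cong k λ i _ → applyUpTo-cong (suc i) λ q _ →
          ≡.cong₂ (λ s t → edge s t (constant rawRing ((- 1#) ^ (2 + i ∸ q ∸ 1))))
                  (≡.cong suc (ℕ.+-suc o q)) (≡.cong suc (ℕ.+-suc o (2 + i))))
        (≡.sym (ascents-block (suc o) k))))))

  act-constant : ∀ x f n → act (constant rawRing x) f n ≈ x R.* f n
  act-constant x f zero    = R.refl
  act-constant x f (suc n) = R.trans (R.+-congˡ (R.zeroˡ _)) (R.+-identityʳ _)

  act-minus : ∀ x f → act (constant rawRing (- 1# R.* x)) f ≋ ⊟ act (constant rawRing x) f
  act-minus x f n = begin-ring
    where
    open RingProperties R.ring using (-1*x≈-x)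
    begin-ring : act (constant rawRing (- 1# R.* x)) f n ≈ - act (constant rawRing x) f n
    begin-ring = R.trans (act-constant _ f n) (R.trans (R.*-assoc _ _ _) (R.trans (-1*x≈-x _)
      (R.-‿cong (R.sym (act-constant x f n)))))

  module _ (z : ℕ → Series) where

    alternating : ℕ → ℕ → Series
    alternating o k = sumTo (λ i → act (constant rawRing ((- 1#) ^ suc i)) (z (suc o + (2 + i)))) k

    alternating-suc : ∀ o k → alternating o (suc k) ≋ ⊟ (z (3 + o) ⊞ alternating (suc o) k)
    alternating-suc o k = begin
      alternating o (suc k)
        ≈⟨ S.∙-cong
             (S.trans (act-minus 1# _) (S.⁻¹-cong (S.trans (one-act _) (S.reflexive (≡.cong z (≡.cong suc (ℕ.+-comm o 2)))))))
             (S.trans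
               (sumTo-cong k λ i → S.trans (act-minus ((- 1#) ^ suc i) _) (S.⁻¹-cong (S.reflexive
                 (≡.cong (λ x → act (constant rawRing ((- 1#) ^ suc i)) (z x)) (≡.cong suc (ℕ.+-suc o (2 + i)))))))
               (sumTo-⊟ _ k)) ⟩
      ⊟ z (3 + o) ⊞ ⊟ alternating (suc o) k
        ≈⟨ ⁻¹-∙-comm _ _ ⟩
      ⊟ (z (3 + o) ⊞ alternating (suc o) k) ∎

    private
      H : Segment → ℕ → Series
      H s = out z (ascents s)

    H-split : ∀ o k a → H (segment o (suc (suc k))) a ≋
              sumTo (λ i → term z (ascent-edge o (2 + i) 0) a) (suc k) ⊞ H (segment (suc o) (suc k)) a
    H-split o k a = S.trans (out-↭ z a (ascents-suc o k)) (S.trans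
      (out-++ z (applyUpTo (λ i → ascent-edge o (2 + i) 0) (suc k)) _ a)
      (S.∙-congʳ (out-applyUpTo z (λ i → ascent-edge o (2 + i) 0) (suc k) a)))

    H-other : ∀ o k {a} → a ≢ suc o → H (segment o (suc (suc k))) a ≋ H (segment (suc o) (suc k)) a
    H-other o k {a} a≢ = S.trans (H-split o k a) (S.trans
      (S.∙-congʳ (sumTo-zero (suc k) λ i _ → term-miss z (ascent-edge o (2 + i) 0)
        (λ eq → a≢ (≡.trans (≡.sym eq) (≡.cong suc (ℕ.+-identityʳ o))))))
      (S.identityˡ _))

    H-low : ∀ o k {a} → a ≤ o → H (segment o (suc k)) a ≋ 0ˢ
    H-low o zero    a≤o = S.refl
    H-low o (suc k) a≤o = S.trans (H-other o k (ℕ.<⇒≢ (s≤s a≤o))) (H-low (suc o) k (ℕ.m≤n⇒m≤1+n a≤o))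

    H-first : ∀ o k → H (segment o (suc k)) (suc o) ≋ alternating o k
    H-first o zero    = S.refl
    H-first o (suc k) = S.trans (H-split o k (suc o)) (S.trans
      (S.∙-cong
        (sumTo-cong (suc k) λ i → term-hit z (ascent-edge o (2 + i) 0) (≡.cong suc (ℕ.+-identityʳ o)))
        (H-low (suc o) k ℕ.≤-refl))
      (S.identityʳ _))

    -- With S_j equal to z_{j+1} plus the signed edges out of j, this is the recursion S_{o+1} +
    -- S_{o+2} = z_{o+2} inside one segment.
    H-recursion : ∀ o k → H (segment o (suc (suc k))) (suc o) ≋ ⊟ (z (3 + o) ⊞ H (segment (suc o) (suc k)) (2 + o))
    H-recursion o k = S.trans (H-first o (suc k)) (S.trans (alternating-suc o k)
      (S.⁻¹-cong (S.∙-congˡ (S.sym (H-first (suc o) k)))))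

    ascent-out : List Segment → ℕ → Series
    ascent-out ss = out z (concatMap ascents ss)

    ascent-out-∷ : ∀ s ss a → ascent-out (s ∷ ss) a ≋ H s a ⊞ ascent-out ss a
    ascent-out-∷ s ss a = out-++ z (ascents s) (concatMap ascents ss) a

    low : ∀ {f o n ss} → Strings f o n ss → ∀ {a} → a ≤ o → ascent-out ss a ≋ 0ˢ
    low []                             a≤o = S.refl
    low (_∷_ {o} {k} {ss = ss} _ rest) a≤o = S.trans (ascent-out-∷ (segment o (suc k)) ss _) (S.trans
      (S.∙-cong (H-low o k a≤o) (low rest (ℕ.≤-trans a≤o (ℕ.m≤m+n o (suc k))))) (S.identityˡ 0ˢ))

    extend-other : ∀ {f o n ss} → Strings f (suc o) (suc n) ss → ∀ {a} → a ≢ suc o →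
                   ascent-out (extend ss) a ≋ ascent-out ss a
    extend-other {o = o} (_∷_ {k = k} {ss = ss} _ rest) {a} a≢ =
      S.trans (ascent-out-∷ (segment o (suc (suc k))) ss a)
        (S.trans (S.∙-congʳ (H-other o k a≢)) (S.sym (ascent-out-∷ (segment (suc o) (suc k)) ss a)))

    extend-first : ∀ {f o n ss} → Strings f (suc o) (suc n) ss →
                   ascent-out (extend ss) (suc o) ≋ ⊟ (z (3 + o) ⊞ ascent-out (extend ss) (2 + o))
    extend-first {o = o} strings@(_∷_ {k = k} {ss = ss} _ rest) = begin
      ascent-out (segment o (suc (suc k)) ∷ ss) (suc o)
        ≈⟨ ascent-out-∷ (segment o (suc (suc k))) ss (suc o) ⟩
      H (segment o (suc (suc k))) (suc o) ⊞ ascent-out ss (suc o)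
        ≈⟨ S.∙-cong (H-recursion o k) (low rest (ℕ.m≤m+n (suc o) (suc k))) ⟩
      ⊟ (z (3 + o) ⊞ H (segment (suc o) (suc k)) (2 + o)) ⊞ 0ˢ
        ≈⟨ S.identityʳ _ ⟩
      ⊟ (z (3 + o) ⊞ H (segment (suc o) (suc k)) (2 + o))
        ≈⟨ S.⁻¹-cong (S.∙-congˡ (S.trans
             (S.sym (S.identityʳ _))
             (S.∙-congˡ (S.sym (low rest (≡.subst (2 + o ≤_) (≡.sym (ℕ.+-suc (suc o) k)) (s≤s (s≤s (ℕ.m≤m+n o k))))))))) ⟩
      ⊟ (z (3 + o) ⊞ (H (segment (suc o) (suc k)) (2 + o) ⊞ ascent-out ss (2 + o)))
        ≈⟨ S.⁻¹-cong (S.∙-congˡ (S.trans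
             (S.sym (ascent-out-∷ (segment (suc o) (suc k)) ss (2 + o)))
             (S.sym (extend-other strings (ℕ.<⇒≢ (ℕ.n<1+n (suc o)) ∘ ≡.sym))))) ⟩
      ⊟ (z (3 + o) ⊞ ascent-out (extend (segment (suc o) (suc k) ∷ ss)) (2 + o)) ∎

    private
      beyond : ∀ b {x} → z x ≋ 0ˢ → 0ˢ ≋ (if b then ⊟ (z x ⊞ 0ˢ) else 0ˢ)
      beyond true  zx≋0 = S.sym (S.trans (S.⁻¹-cong (S.trans (S.identityʳ _) zx≋0)) ε⁻¹≈ε)
      beyond false zx≋0 = S.refl

    -- Comparing neighbouring entries decides whether a segment continues. Past the end of `xs` the
    -- comparison involves a junk value and may succeed by accident; both branches then vanish
    -- because `z` does. Keeping `j` apart from `o + i` lets the index shift of the induction pass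
    -- through an equation.
    ascent-out-recursion : ∀ {n} o (xs : Vec ℤ n) → (∀ x → 1 + o + n < x → z x ≋ 0ˢ) → ∀ i j → j ≡ o + i →
      let out = ascent-out (segmentsFrom 1ℤ o (toList xs)) in
      out (suc j) ≋ (if ⌊ xs ⟨ suc (suc i) ⟩ ℤ.≟ xs ⟨ suc i ⟩ ℤ.+ 1ℤ ⌋ then ⊟ (z (3 + j) ⊞ out (2 + j)) else 0ˢ)
    ascent-out-recursion o [] z≈0 i j ≡.refl = beyond ⌊ 0ℤ ℤ.≟ 0ℤ ℤ.+ 1ℤ ⌋ {3 + (o + i)} (z≈0 _ (ℕ.≤-trans (s≤s (s≤s (ℕ.+-monoʳ-≤ o z≤n))) (ℕ.n≤1+n _)))
    ascent-out-recursion o (x ∷ []) z≈0 i j ≡.refl = beyond ⌊ 0ℤ ℤ.≟ ((x ∷ []) ⟨ suc i ⟩) ℤ.+ 1ℤ ⌋ (z≈0 _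
      (≡.subst (λ k → suc (suc k) ≤ 3 + (o + i)) (ℕ.+-comm 1 o) (s≤s (s≤s (s≤s (ℕ.m≤m+n o i))))))
    ascent-out-recursion o (x ∷ y ∷ xs) z≈0 zero j j≡
      with y ℤ.≟ x ℤ.+ 1ℤ | segmentsFrom-strings 1ℤ {λ _ → false} (suc o) (y ∷ xs) (λ _ _ → ≡.refl)
    ... | yes _ | strings rewrite ≡.trans j≡ (ℕ.+-identityʳ o) = extend-first strings
    ... | no _  | strings rewrite ≡.trans j≡ (ℕ.+-identityʳ o) = low strings ℕ.≤-refl
    ascent-out-recursion {suc (suc n)} o (x ∷ y ∷ xs) z≈0 (suc i) j j≡
      with y ℤ.≟ x ℤ.+ 1ℤ | segmentsFrom-strings 1ℤ {λ _ → false} (suc o) (y ∷ xs) (λ _ _ → ≡.refl)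
         | ascent-out-recursion (suc o) (y ∷ xs) (λ x x> → z≈0 x (≡.subst (λ k → suc (suc k) ≤ x) (≡.sym (ℕ.+-suc o (suc n))) x>))
             i j (≡.trans j≡ (ℕ.+-suc o i))
    ... | no _  | _       | rec = rec
    ... | yes _ | strings | rec = S.trans
      (extend-other strings (ℕ.>⇒≢ (s≤s o<j)))
      (S.trans rec (if-cong ⌊ (y ∷ xs) ⟨ suc (suc i) ⟩ ℤ.≟ (y ∷ xs) ⟨ suc i ⟩ ℤ.+ 1ℤ ⌋ (S.∙-congˡ {z (3 + j)} (S.sym
        (extend-other strings (ℕ.>⇒≢ (s≤s (ℕ.m≤n⇒m≤1+n o<j))))))))
      where
      o<j : o < j
      o<j = ≡.subst (o <_) (≡.sym (≡.trans j≡ (ℕ.+-suc o i))) (s≤s (ℕ.m≤m+n o i))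
      if-cong : ∀ b {f g} → f ≋ g → (if b then ⊟ f else 0ˢ) ≋ (if b then ⊟ g else 0ˢ)
      if-cong true  f≋g = S.⁻¹-cong f≋g
      if-cong false f≋g = S.refl

-- The solution for Γ from the one for Γ′

module Compactification {c ℓ₁ ℓ₂ : Level} (F : HeytingField c ℓ₁ ℓ₂) {r : ℕ} (m : Vec ℤ r)
                        (y : Label → FieldDefs.NonzeroElement F) where
  open FieldDefs F
  open Edge
  open Graphs m y
  open Ascents m
  open Regroup F m y
  open RowEquations F
  open AscentEdges F
  open R using (Carrier; _≈_; 0#; 1#; -_)
  open LinearAlgebra R
  open S using () renaming (_∙_ to infixl 6 _⊞_; ε to 0ˢ; _≈_ to infix 4 _≋_; _⁻¹ to infix 8 ⊟_)
  open SetoidReasoning S.setoid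

  sumTo-⊞ : ∀ f g n → sumTo (λ i → f i ⊞ g i) n ≋ sumTo f n ⊞ sumTo g n
  sumTo-⊞ f g zero    = S.sym (S.identityˡ 0ˢ)
  sumTo-⊞ f g (suc n) = S.trans (S.∙-congˡ (sumTo-⊞ (f ∘ suc) (g ∘ suc) n))
    (CommutativeSemigroupProperties.interchange S.commutativeSemigroup _ _ _ _)

  -- The last hypothesis covers an index outside the range, such as a step beyond the last vertex.
  sumTo-single : ∀ {f} n k → (∀ i → i ≢ k → f i ≋ 0ˢ) → (n ≤ k → f k ≋ 0ˢ) → sumTo f n ≋ f k
  sumTo-single zero    k       f≋0 fk≋0 = S.sym (fk≋0 z≤n)
  sumTo-single (suc n) zero    f≋0 fk≋0 = S.trans
    (S.∙-congˡ (sumTo-zero n λ i _ → f≋0 (suc i) λ ())) (S.identityʳ _)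
  sumTo-single (suc n) (suc k) f≋0 fk≋0 = S.trans
    (S.∙-cong (f≋0 0 λ ()) (sumTo-single n k (λ i i≢k → f≋0 (suc i) (i≢k ∘ ℕ.suc-injective)) (fk≋0 ∘ s≤s)))
    (S.identityˡ _)

  act-t-zero : ∀ x f → act (t* x) f 0 ≈ 0#
  act-t-zero x f = R.zeroˡ _

  act-t-suc : ∀ x f n → act (t* x) f (suc n) ≈ proj₁ x R.* f n
  act-t-suc x f n = R.trans (R.+-congʳ (R.zeroˡ _)) (R.+-identityˡ _)

  -- Both sides are the product of `f` with x x′ t².
  act-t-comm : ∀ x x′ f → act (t* x) (act (t* x′) f) ≋ act (t* x′) (act (t* x) f)
  act-t-comm x x′ f zero          = R.trans (act-t-zero x (act (t* x′) f)) (R.sym (act-t-zero x′ (act (t* x) f)))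
  act-t-comm x x′ f (suc zero)    = R.trans (vanish x x′) (R.sym (vanish x′ x))
    where
    vanish : ∀ x x′ → act (t* x) (act (t* x′) f) 1 ≈ 0#
    vanish x x′ = R.trans (act-t-suc x (act (t* x′) f) 0) (R.trans (R.*-congˡ (act-t-zero x′ f)) (R.zeroʳ _))
  act-t-comm x x′ f (suc (suc n)) = R.trans (expand x x′) (R.trans
    (CommutativeSemigroupProperties.x∙yz≈y∙xz R.*-commutativeSemigroup _ _ _) (R.sym (expand x′ x)))
    where
    expand : ∀ x x′ → act (t* x) (act (t* x′) f) (2 + n) ≈ proj₁ x R.* (proj₁ x′ R.* f n)
    expand x x′ = R.trans (act-t-suc x (act (t* x′) f) (suc n)) (R.*-congˡ (act-t-suc x′ f n))

  -- The factors c_j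

  τ : ℕ → Series → Series
  τ α = act (t* y (odd α))

  -- Multiplication by the product of the weights t y_{2α-1} over the
  -- ascents m_α = m_{α-1} + 1 with 2 ≤ α ≤ i+1.
  scale : ℕ → Series → Series
  scale zero    f = f
  scale (suc i) f = if ascent (suc i) then τ (2 + i) (scale i f) else scale i f

  scale-true : ∀ i {f} → ascent (suc i) ≡ true → scale (suc i) f ≡ τ (2 + i) (scale i f)
  scale-true i eq rewrite eq = ≡.refl

  scale-false : ∀ i {f} → ascent (suc i) ≡ false → scale (suc i) f ≡ scale i f
  scale-false i eq rewrite eq = ≡.refl

  scale-cong : ∀ i {f g} → f ≋ g → scale i f ≋ scale i g
  scale-cong zero    f≋g = f≋g
  scale-cong (suc i) f≋g with ascent (suc i)
  ... | true  = act-cong (λ _ → R.refl) (scale-cong i f≋g)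
  ... | false = scale-cong i f≋g

  scale-⊞ : ∀ i f g → scale i (f ⊞ g) ≋ scale i f ⊞ scale i g
  scale-⊞ zero    f g = S.refl
  scale-⊞ (suc i) f g with ascent (suc i)
  ... | true  = S.trans (act-cong (λ _ → R.refl) (scale-⊞ i f g)) (act-+ _ _ _)
  ... | false = scale-⊞ i f g

  scale-0 : ∀ i {f} → f ≋ 0ˢ → scale i f ≋ 0ˢ
  scale-0 zero    f≋0 = f≋0
  scale-0 (suc i) f≋0 with ascent (suc i)
  ... | true  = act-zero (scale-0 i f≋0)
  ... | false = scale-0 i f≋0

  scale-act : ∀ i x f → scale i (act (t* x) f) ≋ act (t* x) (scale i f)
  scale-act zero    x f = S.refl
  scale-act (suc i) x f with ascent (suc i)
  ... | true  = S.trans (act-cong (λ _ → R.refl) (scale-act i x f)) (act-t-comm (y (odd (2 + i))) x (scale i f))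
  ... | false = scale-act i x f

  scale-string : ∀ o k → (∀ q → q < k → ascent (suc (o + q)) ≡ false) → ∀ q → q ≤ k → ∀ f → scale (o + q) f ≡ scale o f
  scale-string o k inner zero    q≤k f = ≡.cong (λ i → scale i f) (ℕ.+-identityʳ o)
  scale-string o k inner (suc q) q<k f = ≡.trans
    (≡.cong (λ i → scale i f) (ℕ.+-suc o q))
    (≡.trans (scale-false (o + q) (inner q q<k)) (scale-string o k inner q (ℕ.<⇒≤ q<k) f))

  -- Admissibility of the edges of both graphs

  admissible-t : ∀ {s t} x → Admissible (edge s t (t* x))
  admissible-t x = admissible (λ _ → R.refl) (inj₂ R.refl)

  admissible-constant : ∀ {s t} x → s < t → Admissible (edge s t (constant rawRing x))
  admissible-constant x s<t = admissible (λ _ → R.refl) (inj₁ s<t)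

  All-block : ∀ {p} {P : Edge → Set p} (es : ℕ → List Edge) n → (∀ i → i < n → All P (es i)) → All P (block es n)
  All-block es n all = All.concat⁺ (All.applyUpTo⁺₁ es n λ {i} → all i)

  All-descents : ∀ {p} {P : Edge → Set p} {o n ss} → Strings ascent o n ss →
    (∀ o k → (∀ q → q < k → ascent (suc (o + q)) ≡ false) → ∀ i q → i < k → q ≤ i → P (descent-edge o i q)) →
    All P (concatMap descents ss)
  All-descents []                       P-edge = []
  All-descents {P = P} (_∷_ {o} {k} {ss = ss} inner strings) P-edge = All.++⁺
    (≡.subst (All P) (≡.sym (descents-block o k)) (All-block (λ i → applyUpTo (descent-edge o i) (suc i)) k λ i i<k →
      All.applyUpTo⁺₁ (descent-edge o i) (suc i) λ {q} q<1+i → P-edge o k inner i q i<k (s≤s⁻¹ q<1+i)))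
    (All-descents strings P-edge)

  vertex-< : ∀ i → vertex i < 2 * suc i
  vertex-< i = ≡.subst (vertex i <_) (≡.cong suc (≡.sym (ℕ.+-suc i (i + 0)))) (s≤s bound)
    where
    bound : vertex i ≤ suc (2 * i)
    bound with ascent i
    ... | true  = ℕ.≤-refl
    ... | false = ℕ.n≤1+n _

  Γ-admissible : All Admissible Γ
  Γ-admissible = All-resp-↭ (↭-sym Γ-↭) (All.++⁺
    (All-block evenEdges r λ i _ → admissible-t (y (even (suc i))) ∷ admissible-constant 1# (vertex-< i) ∷ [])
    (All.++⁺
      (All-block oddEdges (suc r) λ i _ → admissible-t (y (odd (suc i))) ∷ admissible-constant 1# ℕ.≤-refl ∷ [])
      (All.map⁺ (All-descents descending-strings λ o k _ i q _ _ → admissible-t (redundant (suc o + q) (suc o + (2 + i)))))))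

  steps : ℕ → List Edge
  steps i = edge (suc i) (2 + i) oneₜ ∷ edge (2 + i) (suc i) (t* y (even (suc i))) ∷ []

  loop : ℕ → Edge
  loop i = edge (suc i) (suc i) (t* y (odd (suc i)))

  Γ′-edges : Γ′ ≡ block steps r ++ (applyUpTo loop (suc r) ++ (concatMap descents (descending m) ++ concatMap ascents (ascending m)))
  Γ′-edges = ≡.cong₂ _++_
    (concatMap-range (λ i → edge i (suc i) oneₜ ∷ edge (suc i) i (t* y (even i)) ∷ []) 1 r)
    (≡.cong (_++ (concatMap descents (descending m) ++ concatMap ascents (ascending m))) (map-range (λ i → edge i i (t* y (odd i))) 1 (suc r)))

  All-ascents : ∀ {p} {P : Edge → Set p} {f o n ss} → Strings f o n ss →
    (∀ o i q → q ≤ i → P (ascent-edge o (2 + i) q)) → All P (concatMap ascents ss)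
  All-ascents []                                P-edge = []
  All-ascents {P = P} (_∷_ {o} {k} {ss = ss} inner strings) P-edge = All.++⁺
    (≡.subst (All P) (≡.sym (ascents-block o k)) (All-block (λ i → applyUpTo (ascent-edge o (2 + i)) (suc i)) k λ i _ →
      All.applyUpTo⁺₁ (ascent-edge o (2 + i)) (suc i) λ {q} q<1+i → P-edge o i q (s≤s⁻¹ q<1+i)))
    (All-ascents strings P-edge)

  Γ′-admissible : All Admissible Γ′
  Γ′-admissible = ≡.subst (All Admissible) (≡.sym Γ′-edges) (All.++⁺
    (All-block steps r λ i _ → admissible-constant 1# ℕ.≤-refl ∷ admissible-t (y (even (suc i))) ∷ [])
    (All.++⁺
      (All.applyUpTo⁺₁ loop (suc r) λ {i} _ → admissible-t (y (odd (suc i))))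
      (All.++⁺
        (All-descents descending-strings λ o k _ i q _ _ → admissible-t (redundant (suc o + q) (suc o + (2 + i))))
        (All-ascents (segmentsFrom-strings 1ℤ {λ _ → false} 0 m (λ _ _ → ≡.refl)) λ o i q q≤i →
          admissible-constant _ (s≤s (ℕ.+-monoʳ-< o (s≤s (ℕ.m≤n⇒m≤1+n q≤i))))))))

  -- From a solution for Γ′ to a solution for Γ

  module Row (z : ℕ → Series) (z-beyond : ∀ x → suc r < x → z x ≋ 0ˢ)
             (z-first : z 1 ≋ oneₜ ⊞ out z Γ′ 1)
             (z-later : ∀ i → suc i ≤ r → z (2 + i) ≋ out z Γ′ (2 + i)) where

    -- ahead j = z_{j+1} - z_{j+2} + …, the sum over the edges of Γ′ from j
    -- to larger vertices.
    behind ahead : ℕ → Series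
    behind = out z (concatMap descents (descending m))
    ahead i = z (suc i) ⊞ ascent-out z (ascending m) i

    ascents-recursion : ∀ i → ascent-out z (ascending m) (suc i) ≋ (if ascent (suc i) then ⊟ ahead (2 + i) else 0ˢ)
    ascents-recursion i = ascent-out-recursion z 0 m z-beyond i i ≡.refl

    ahead-ascent : ∀ i → ascent (suc i) ≡ true → ahead (suc i) ⊞ ahead (2 + i) ≋ z (2 + i)
    ahead-ascent i asc = begin
      z (2 + i) ⊞ ascent-out z (ascending m) (suc i) ⊞ ahead (2 + i)
        ≈⟨ S.assoc _ _ _ ⟩
      z (2 + i) ⊞ (ascent-out z (ascending m) (suc i) ⊞ ahead (2 + i))
        ≈⟨ S.∙-congˡ (S.∙-congʳ (S.trans (ascents-recursion i) (S.reflexive (≡.cong (if_then ⊟ ahead (2 + i) else 0ˢ) asc)))) ⟩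
      z (2 + i) ⊞ (⊟ ahead (2 + i) ⊞ ahead (2 + i))
        ≈⟨ S.∙-congˡ (S.inverseˡ _) ⟩
      z (2 + i) ⊞ 0ˢ
        ≈⟨ S.identityʳ _ ⟩
      z (2 + i) ∎

    ahead-¬ascent : ∀ i → ascent (suc i) ≡ false → ahead (suc i) ≋ z (2 + i)
    ahead-¬ascent i ¬asc = S.trans (S.∙-congˡ (S.trans (ascents-recursion i) (S.reflexive (≡.cong (if_then ⊟ ahead (2 + i) else 0ˢ) ¬asc))))
      (S.identityʳ _)

    ascent-beyond : ∀ i → r < suc i → ascent (suc i) ≡ false
    ascent-beyond i r<1+i rewrite ⟨⟩-beyond m (ℕ.m≤n⇒m≤1+n r<1+i) | ⟨⟩-beyond m r<1+i = ≡.refl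

    ahead-beyond : ∀ i → r < suc i → ahead (suc i) ≋ 0ˢ
    ahead-beyond i r<1+i = S.trans (ahead-¬ascent i (ascent-beyond i r<1+i)) (z-beyond (2 + i) (s≤s r<1+i))

    source-descents : ∀ {a} → a ≤ 1 → behind a ≋ 0ˢ
    source-descents {a} a≤1 = go (All-descents {P = λ e → 1 < source e} descending-strings
      λ o k _ i q _ _ → s≤s (≡.subst (1 ≤_) (≡.sym (ℕ.+-suc o (suc i))) (s≤s z≤n)))
      where
      go : ∀ {es} → All (λ e → 1 < source e) es → out z es a ≋ 0ˢ
      go []             = S.refl
      go {e ∷ _} (1<s ∷ all) = S.trans
        (S.∙-cong (term-miss z e (ℕ.>⇒≢ (ℕ.≤-<-trans a≤1 1<s))) (go all)) (S.identityˡ 0ˢ)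

    behind-first : behind 1 ≋ 0ˢ
    behind-first = source-descents ℕ.≤-refl

    split-Γ′ : ∀ a → out z Γ′ a ≋ (sumTo (λ i → term z (edge (suc i) (2 + i) oneₜ) a) r ⊞
                                    sumTo (λ i → term z (edge (2 + i) (suc i) (t* y (even (suc i)))) a) r) ⊞
                                   (sumTo (λ i → term z (loop i) a) (suc r) ⊞ (behind a ⊞ ascent-out z (ascending m) a))
    split-Γ′ a = begin
      out z Γ′ a
        ≈⟨ S.reflexive (≡.cong (λ es → out z es a) Γ′-edges) ⟩
      out z (block steps r ++ _) a
        ≈⟨ out-++ z (block steps r) _ a ⟩
      out z (block steps r) a ⊞ out z (applyUpTo loop (suc r) ++ _) a
        ≈⟨ S.∙-cong
             (S.trans (out-block z steps r a) (S.trans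
               (sumTo-cong r λ i → S.∙-congˡ (S.identityʳ _)) (sumTo-⊞ _ _ r)))
             (S.trans (out-++ z (applyUpTo loop (suc r)) _ a)
               (S.∙-cong (out-applyUpTo z loop (suc r) a) (out-++ z (concatMap descents (descending m)) _ a))) ⟩
      _ ∎

    step-sum : ∀ i → sumTo (λ j → term z (edge (suc j) (2 + j) oneₜ) (suc i)) r ≋ z (2 + i)
    step-sum i = S.trans
      (sumTo-single r i (λ j j≢i → term-miss z _ (j≢i ∘ ℕ.suc-injective))
        (λ r≤i → S.trans hit (z-beyond (2 + i) (s≤s (s≤s r≤i)))))
      hit
      where
      hit : term z (edge (suc i) (2 + i) oneₜ) (suc i) ≋ z (2 + i)
      hit = S.trans (term-hit z (edge (suc i) (2 + i) oneₜ) ≡.refl) (one-act _)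

    loop-sum : ∀ i → i ≤ r → sumTo (λ j → term z (loop j) (suc i)) (suc r) ≋ τ (suc i) (z (suc i))
    loop-sum i i≤r = S.trans
      (sumTo-single (suc r) i (λ j j≢i → term-miss z (loop j) (j≢i ∘ ℕ.suc-injective)) (λ r<i → contradiction i≤r (ℕ.<⇒≱ r<i)))
      (term-hit z (loop i) ≡.refl)

    equation-first : z 1 ≋ oneₜ ⊞ (ahead 1 ⊞ τ 1 (z 1))
    equation-first = S.trans z-first (S.∙-congˡ (S.trans (split-Γ′ 1) (S.trans
      (S.∙-cong
        (S.∙-cong (step-sum 0) (sumTo-zero r λ j _ → term-miss z (edge (2 + j) (suc j) (t* y (even (suc j)))) {1} λ ()))
        (S.∙-cong (loop-sum 0 z≤n) (S.∙-congʳ behind-first)))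
      (solve 4 (λ u l a o → (u ⊕ id) ⊕ (l ⊕ (id ⊕ a)) ⊜ (u ⊕ a) ⊕ l) S.refl (z 2) (τ 1 (z 1)) (ascent-out z (ascending m) 1) 0ˢ))))
      where open CommutativeMonoidSolver S.commutativeMonoid

    -- Grouped for the comparison with Γ: the edges to smaller vertices are merely rescaled there,
    -- whereas the forward edges and the loop are rearranged.
    equation : ∀ i → suc i ≤ r →
      z (2 + i) ≋ (act (t* y (even (suc i))) (z (suc i)) ⊞ behind (2 + i)) ⊞ (ahead (2 + i) ⊞ τ (2 + i) (z (2 + i)))
    equation i i<r = S.trans (z-later i i<r) (S.trans (split-Γ′ (2 + i)) (S.trans
      (S.∙-cong
        (S.∙-cong (step-sum (suc i)) down)
        (S.∙-congʳ (loop-sum (suc i) i<r)))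
      (solve 5 (λ u e l d a → (u ⊕ e) ⊕ (l ⊕ (d ⊕ a)) ⊜ (e ⊕ d) ⊕ ((u ⊕ a) ⊕ l)) S.refl
        (z (3 + i)) (act (t* y (even (suc i))) (z (suc i))) (τ (2 + i) (z (2 + i))) (behind (2 + i)) (ascent-out z (ascending m) (2 + i)))))
      where
      open CommutativeMonoidSolver S.commutativeMonoid
      e : ℕ → Edge
      e j = edge (2 + j) (suc j) (t* y (even (suc j)))
      down : sumTo (λ j → term z (e j) (2 + i)) r ≋ act (t* y (even (suc i))) (z (suc i))
      down = S.trans
        (sumTo-single r i (λ j j≢i → term-miss z (e j) (j≢i ∘ ℕ.suc-injective ∘ ℕ.suc-injective)) (λ r≤i → contradiction i<r (ℕ.≤⇒≯ r≤i)))
        (term-hit z (e i) ≡.refl)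

    -- The values at the even and at the odd vertices of Γ.
    Zᵉ Zᵒ Z : ℕ → Series
    -- The only edge out of the root has weight 1 and leads to vertex 1. The edge back to the root
    -- thereby reproduces the loop of Γ′ at 1.
    Zᵉ zero    = z 1
    -- Where m does not ascend, S_{i+1} = z_{i+2}; one formula thus covers all even vertices but the
    -- root.
    Zᵉ (suc i) = scale i (ahead (suc i))
    Zᵒ zero    = z 1
    -- The right-hand side of the equation at this vertex, which is a leaf unless m ascends.
    Zᵒ (suc i) = τ (2 + i) (Zᵉ (suc i)) ⊞ (if ascent (suc i) then Zᵉ (2 + i) else 0ˢ)
    Z = interleave Zᵉ Zᵒ

    Z-even : ∀ i → Z (2 * i) ≋ Zᵉ i
    Z-even i = S.reflexive (interleave-even Zᵉ Zᵒ i)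

    Z-odd : ∀ i → Z (suc (2 * i)) ≋ Zᵒ i
    Z-odd i = S.reflexive (interleave-odd Zᵉ Zᵒ i)

    Zᵉ-beyond : ∀ i → r < i → Zᵉ i ≋ 0ˢ
    Zᵉ-beyond (suc i) r<i = scale-0 i (ahead-beyond i r<i)

    Zᵒ-beyond : ∀ i → r < i → Zᵒ i ≋ 0ˢ
    Zᵒ-beyond (suc i) r<i = S.trans (S.∙-cong (act-zero (Zᵉ-beyond (suc i) r<i))
      (S.reflexive (≡.cong (if_then Zᵉ (2 + i) else 0ˢ) (ascent-beyond i r<i)))) (S.identityˡ 0ˢ)

    Z-beyond : ∀ x → 2 + 2 * r ≤ x → Z x ≋ 0ˢ
    Z-beyond x x> with parity x
    ... | inj₁ (i , ≡.refl) = S.trans (Z-even i) (Zᵉ-beyond i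
      (ℕ.*-cancelˡ-≤ 2 (≡.subst (_≤ 2 * i) (≡.cong suc (≡.sym (ℕ.+-suc r (r + 0)))) x>)))
    ... | inj₂ (i , ≡.refl) = S.trans (Z-odd i) (Zᵒ-beyond i
      (ℕ.*-cancelˡ-< 2 r i (s≤s⁻¹ x>)))

    -- At an ascent, S_{i+1} + S_{i+2} = z_{i+2} collapses the two terms of `Zᵒ` into one.
    Z-vertex : ∀ i → Z (vertex i) ≋ scale i (z (suc i))
    Z-vertex zero = S.refl
    Z-vertex (suc i) with ascent (suc i) in asc
    ... | true  = begin
      Z (suc (2 * suc i))
        ≈⟨ Z-odd (suc i) ⟩
      τ (2 + i) (scale i (ahead (suc i))) ⊞ (if ascent (suc i) then scale (suc i) (ahead (2 + i)) else 0ˢ)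
        ≈⟨ S.∙-congˡ (S.reflexive (≡.trans (≡.cong (if_then scale (suc i) (ahead (2 + i)) else 0ˢ) asc) (scale-true i asc))) ⟩
      τ (2 + i) (scale i (ahead (suc i))) ⊞ τ (2 + i) (scale i (ahead (2 + i)))
        ≈⟨ act-+ _ _ _ ⟨
      τ (2 + i) (scale i (ahead (suc i)) ⊞ scale i (ahead (2 + i)))
        ≈⟨ act-cong (λ _ → R.refl) (S.trans (S.sym (scale-⊞ i _ _)) (scale-cong i (ahead-ascent i asc))) ⟩
      τ (2 + i) (scale i (z (2 + i))) ∎
    ... | false = S.trans (Z-even (suc i)) (scale-cong i (ahead-¬ascent i asc))

    -- The equations at the vertices of Γ

    down↓ up↑ : ℕ → Edge
    down↓ i = edge (2 * suc i) (vertex i) (t* y (even (suc i)))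
    up↑ i   = edge (vertex i) (2 * suc i) oneₜ

    leaf↓ leaf↑ : ℕ → Edge
    leaf↓ i = edge (suc (2 * i)) (2 * i) (t* y (odd (suc i)))
    leaf↑ i = edge (2 * i) (suc (2 * i)) oneₜ

    DΓ : ℕ → Series
    DΓ = out Z (List.map relocate (concatMap descents (descending m)))

    split-Γ : ∀ a → out Z Γ a ≋ (sumTo (λ i → term Z (down↓ i) a) r ⊞ sumTo (λ i → term Z (up↑ i) a) r) ⊞
                                ((sumTo (λ i → term Z (leaf↓ i) a) (suc r) ⊞ sumTo (λ i → term Z (leaf↑ i) a) (suc r)) ⊞ DΓ a)
    split-Γ a = begin
      out Z Γ a
        ≈⟨ out-↭ Z a Γ-↭ ⟩
      out Z (block evenEdges r ++ _) a
        ≈⟨ out-++ Z (block evenEdges r) _ a ⟩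
      out Z (block evenEdges r) a ⊞ out Z (block oddEdges (suc r) ++ _) a
        ≈⟨ S.∙-cong
             (S.trans (out-block Z evenEdges r a) (S.trans (sumTo-cong r λ i → S.∙-congˡ (S.identityʳ _)) (sumTo-⊞ _ _ r)))
             (S.trans (out-++ Z (block oddEdges (suc r)) _ a) (S.∙-congʳ
               (S.trans (out-block Z oddEdges (suc r) a) (S.trans (sumTo-cong {g = λ i → leaf↓-term i ⊞ leaf↑-term i} (suc r) λ i → S.∙-congˡ (S.identityʳ (leaf↑-term i))) (sumTo-⊞ leaf↓-term leaf↑-term (suc r)))))) ⟩
      _ ∎
      where
      leaf↓-term leaf↑-term : ℕ → Series
      leaf↓-term i = term Z (leaf↓ i) a
      leaf↑-term i = term Z (leaf↑ i) a

    2*-injective : ∀ {i j} → 2 * i ≡ 2 * j → i ≡ j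
    2*-injective {i} {j} = ℕ.*-cancelˡ-≡ i j 2

    down-even : ∀ i → i < r → sumTo (λ j → term Z (down↓ j) (2 * suc i)) r ≋ act (t* y (even (suc i))) (scale i (z (suc i)))
    down-even i i<r = S.trans
      (sumTo-single r i (λ j j≢i → term-miss Z (down↓ j) (λ eq → j≢i (ℕ.suc-injective (2*-injective {suc j} {suc i} eq))))
        (λ r≤i → contradiction i<r (ℕ.≤⇒≯ r≤i)))
      (S.trans (term-hit Z (down↓ i) {2 * suc i} ≡.refl) (act-cong (λ _ → R.refl) (Z-vertex i)))

    down-zero : sumTo (λ j → term Z (down↓ j) 0) r ≋ 0ˢ
    down-zero = sumTo-zero r λ j _ → term-miss Z (down↓ j) {0} λ ()

    down-odd : ∀ i → sumTo (λ j → term Z (down↓ j) (suc (2 * i))) r ≋ 0ˢ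
    down-odd i = sumTo-zero r λ j _ → term-miss Z (down↓ j) (ℕ.even≢odd (suc j) i)

    vertex-even : ∀ i j → vertex j ≡ 2 * i → j ≡ i × ascent j ≡ false
    vertex-even i j eq with ascent j
    ... | true  = contradiction (≡.sym eq) (ℕ.even≢odd i j)
    ... | false = 2*-injective eq , ≡.refl

    vertex-odd : ∀ i j → vertex j ≡ suc (2 * i) → j ≡ i × ascent j ≡ true
    vertex-odd i j eq with ascent j
    ... | true  = 2*-injective (ℕ.suc-injective eq) , ≡.refl
    ... | false = contradiction eq (ℕ.even≢odd j i)

    -- For `i = r` there is no such edge, but `Zᵉ (suc r)` vanishes.
    up-single : ∀ i a → vertex i ≡ a → (∀ j → vertex j ≡ a → j ≡ i) → sumTo (λ j → term Z (up↑ j) a) r ≋ Zᵉ (suc i)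
    up-single i a hit unique = S.trans
      (sumTo-single r i (λ j j≢i → term-miss Z (up↑ j) (j≢i ∘ unique j))
        (λ r≤i → S.trans value (Zᵉ-beyond (suc i) (s≤s r≤i))))
      value
      where
      value : term Z (up↑ i) a ≋ Zᵉ (suc i)
      value = S.trans (term-hit Z (up↑ i) hit) (S.trans (one-act _) (Z-even (suc i)))

    up-even : ∀ i → sumTo (λ j → term Z (up↑ j) (2 * i)) r ≋ (if ascent i then 0ˢ else Zᵉ (suc i))
    up-even i = go (ascent i) ≡.refl
      where
      go : ∀ b → ascent i ≡ b → sumTo (λ j → term Z (up↑ j) (2 * i)) r ≋ (if b then 0ˢ else Zᵉ (suc i))
      go true  asc = sumTo-zero r λ j _ → term-miss Z (up↑ j) λ eq → let (j≡i , ¬asc) = vertex-even i j eq in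
        contradiction (≡.trans (≡.sym ¬asc) (≡.trans (≡.cong ascent j≡i) asc)) λ ()
      go false asc = up-single i (2 * i) (vertex-false i asc) (λ j eq → proj₁ (vertex-even i j eq))

    up-odd : ∀ i → sumTo (λ j → term Z (up↑ j) (suc (2 * i))) r ≋ (if ascent i then Zᵉ (suc i) else 0ˢ)
    up-odd i = go (ascent i) ≡.refl
      where
      go : ∀ b → ascent i ≡ b → sumTo (λ j → term Z (up↑ j) (suc (2 * i))) r ≋ (if b then Zᵉ (suc i) else 0ˢ)
      go false ¬asc = sumTo-zero r λ j _ → term-miss Z (up↑ j) λ eq → let (j≡i , asc) = vertex-odd i j eq in
        contradiction (≡.trans (≡.sym asc) (≡.trans (≡.cong ascent j≡i) ¬asc)) λ ()
      go true  asc = up-single i (suc (2 * i)) (vertex-true i asc) (λ j eq → proj₁ (vertex-odd i j eq))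

    leaf-even : ∀ i → i ≤ r → sumTo (λ j → term Z (leaf↓ j) (2 * i)) (suc r) ⊞ sumTo (λ j → term Z (leaf↑ j) (2 * i)) (suc r) ≋ Zᵒ i
    leaf-even i i≤r = S.trans
      (S.∙-cong
        (sumTo-zero (suc r) λ j _ → term-miss Z (leaf↓ j) (ℕ.even≢odd i j ∘ ≡.sym))
        (S.trans
          (sumTo-single (suc r) i (λ j j≢i → term-miss Z (leaf↑ j) (j≢i ∘ 2*-injective)) (λ r<i → contradiction i≤r (ℕ.<⇒≱ r<i)))
          (S.trans (term-hit Z (leaf↑ i) {2 * i} ≡.refl) (S.trans (one-act _) (Z-odd i)))))
      (S.identityˡ _)

    leaf-odd : ∀ i → i ≤ r → sumTo (λ j → term Z (leaf↓ j) (suc (2 * i))) (suc r) ⊞ sumTo (λ j → term Z (leaf↑ j) (suc (2 * i))) (suc r) ≋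
                             τ (suc i) (Zᵉ i)
    leaf-odd i i≤r = S.trans
      (S.∙-cong
        (S.trans
          (sumTo-single (suc r) i (λ j j≢i → term-miss Z (leaf↓ j) (j≢i ∘ 2*-injective ∘ ℕ.suc-injective)) (λ r<i → contradiction i≤r (ℕ.<⇒≱ r<i)))
          (S.trans (term-hit Z (leaf↓ i) {suc (2 * i)} ≡.refl) (act-cong (λ _ → R.refl) (Z-even i))))
        (sumTo-zero (suc r) λ j _ → term-miss Z (leaf↑ j) (ℕ.even≢odd j i)))
      (S.identityʳ _)

    DΓ-odd : ∀ i → DΓ (suc (2 * i)) ≋ 0ˢ
    DΓ-odd i = go (concatMap descents (descending m))
      where
      go : ∀ es → out Z (List.map relocate es) (suc (2 * i)) ≋ 0ˢ
      go []       = S.refl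
      go (e ∷ es) = S.trans (S.∙-cong (term-miss Z (relocate e) (ℕ.even≢odd (pred (source e)) i)) (go es)) (S.identityˡ 0ˢ)

    -- The scale is constant along a string.
    DΓ-even : ∀ i → DΓ (2 * suc i) ≋ scale i (behind (2 + i))
    DΓ-even i = go (All-descents descending-strings edges)
      where
      Relocated : Edge → Set ℓ₁
      Relocated e = term Z (relocate e) (2 * suc i) ≋ scale i (term z e (2 + i))
      go : ∀ {es} → All Relocated es → out Z (List.map relocate es) (2 * suc i) ≋ scale i (out z es (2 + i))
      go []              = S.sym (scale-0 i S.refl)
      go {e ∷ es} (p ∷ ps) = S.trans (S.∙-cong p (go ps)) (S.sym (scale-⊞ i (term z e (2 + i)) (out z es (2 + i))))
      edges : ∀ o k → (∀ q → q < k → ascent (suc (o + q)) ≡ false) → ∀ j q → j < k → q ≤ j → Relocated (descent-edge o j q)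
      edges o k inner j q j<k q≤j with (o + (2 + j)) ℕ.≟ suc i
      ... | no off  = S.trans
        (term-miss Z (relocate (descent-edge o j q)) (off ∘ 2*-injective {o + (2 + j)} {suc i}))
        (S.sym (scale-0 i (term-miss z (descent-edge o j q) (off ∘ ℕ.suc-injective))))
      ... | yes on = begin
        term Z (relocate (descent-edge o j q)) (2 * suc i)
          ≈⟨ term-hit Z (relocate (descent-edge o j q)) (≡.cong (2 *_) on) ⟩
        act w (Z (vertex (o + q)))
          ≈⟨ act-cong (λ _ → R.refl) (Z-vertex (o + q)) ⟩
        act w (scale (o + q) (z (suc o + q)))
          ≈⟨ S.reflexive (≡.cong (act w) (≡.trans
               (scale-string o k inner q (ℕ.≤-trans q≤j (ℕ.<⇒≤ j<k)) _)
               (≡.trans (≡.sym (scale-string o k inner (suc j) j<k _)) (≡.cong (λ l → scale l (z (suc o + q))) o+1+j≡i)))) ⟩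
        act w (scale i (z (suc o + q)))
          ≈⟨ scale-act i (redundant (suc o + q) (suc o + (2 + j))) (z (suc o + q)) ⟨
        scale i (act w (z (suc o + q)))
          ≈⟨ scale-cong i (term-hit z (descent-edge o j q) (≡.cong suc on)) ⟨
        scale i (term z (descent-edge o j q) (2 + i)) ∎
        where
        w : Series
        w = t* redundant (suc o + q) (suc o + (2 + j))
        o+1+j≡i : o + suc j ≡ i
        o+1+j≡i = ℕ.suc-injective (≡.trans (≡.sym (ℕ.+-suc o (suc j))) on)

    DΓ-zero : DΓ 0 ≋ 0ˢ
    DΓ-zero = go (All-descents {P = λ e → 1 < source e} descending-strings
      λ o k _ i q _ _ → s≤s (≡.subst (1 ≤_) (≡.sym (ℕ.+-suc o (suc i))) (s≤s z≤n)))
      where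
      go : ∀ {es} → All (λ e → 1 < source e) es → out Z (List.map relocate es) 0 ≋ 0ˢ
      go []                                     = S.refl
      go {edge (suc (suc s)) t w ∷ _} (_ ∷ all) = S.trans (S.identityˡ _) (go all)
      go {edge (suc zero) t w ∷ _} (s≤s () ∷ all)

    row-0 : Z 0 ≋ out Z Γ 0
    row-0 = S.sym (S.trans (split-Γ 0) (S.trans
      (S.∙-cong (S.∙-cong down-zero (up-even 0)) (S.∙-cong (leaf-even 0 z≤n) DΓ-zero))
      (solve 1 (λ a → (id ⊕ id) ⊕ (a ⊕ id) ⊜ a) S.refl (z 1))))
      where open CommutativeMonoidSolver S.commutativeMonoid

    row-1 : Z 1 ≋ oneₜ ⊞ out Z Γ 1
    row-1 = S.trans equation-first (S.∙-congˡ (S.sym (S.trans (split-Γ 1) (S.trans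
      (S.∙-cong (S.∙-cong (down-odd 0) (up-odd 0)) (S.∙-cong (leaf-odd 0 z≤n) (DΓ-odd 0)))
      (solve 2 (λ a b → (id ⊕ a) ⊕ (b ⊕ id) ⊜ a ⊕ b) S.refl (ahead 1) (τ 1 (z 1)))))))
      where open CommutativeMonoidSolver S.commutativeMonoid

    row-odd : ∀ i → suc i ≤ r → Z (suc (2 * suc i)) ≋ out Z Γ (suc (2 * suc i))
    row-odd i i<r = S.trans (Z-odd (suc i)) (S.sym (S.trans (split-Γ (suc (2 * suc i))) (S.trans
      (S.∙-cong (S.∙-cong (down-odd (suc i)) (up-odd (suc i))) (S.∙-cong (leaf-odd (suc i) i<r) (DΓ-odd (suc i))))
      (solve 2 (λ a b → (id ⊕ a) ⊕ (b ⊕ id) ⊜ b ⊕ a) S.refl (if ascent (suc i) then Zᵉ (2 + i) else 0ˢ) (τ (2 + i) (Zᵉ (suc i)))))))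
      where open CommutativeMonoidSolver S.commutativeMonoid

    row-even : ∀ i → suc i ≤ r → Z (2 * suc i) ≋ out Z Γ (2 * suc i)
    row-even i i<r = S.trans (Z-even (suc i)) (S.sym (S.trans (split-Γ (2 * suc i)) (S.trans
      (S.∙-cong (S.∙-cong (down-even i i<r) (up-even (suc i))) (S.∙-cong (leaf-even (suc i) i<r) (DΓ-even i)))
      (S.trans
        (solve 5 (λ e n t a d → (e ⊕ n) ⊕ ((t ⊕ a) ⊕ d) ⊜ (e ⊕ d) ⊕ (n ⊕ (t ⊕ a))) S.refl
          evens (if ascent (suc i) then 0ˢ else Zᵉ (2 + i)) (τ (2 + i) (Zᵉ (suc i))) (if ascent (suc i) then Zᵉ (2 + i) else 0ˢ) (scale i (behind (2 + i))))
        (S.trans (S.∙-congʳ backward≋) (balance (ascent (suc i)) ≡.refl))))))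
      where
      open CommutativeMonoidSolver S.commutativeMonoid
      evens backward : Series
      evens    = act (t* y (even (suc i))) (scale i (z (suc i)))
      backward = act (t* y (even (suc i))) (z (suc i)) ⊞ behind (2 + i)
      backward≋ : evens ⊞ scale i (behind (2 + i)) ≋ scale i backward
      backward≋ = S.sym (S.trans (scale-⊞ i _ _) (S.∙-congʳ (scale-act i (y (even (suc i))) (z (suc i)))))
      balance : ∀ b → ascent (suc i) ≡ b →
        scale i backward ⊞ ((if b then 0ˢ else Zᵉ (2 + i)) ⊞ (τ (2 + i) (scale i (ahead (suc i))) ⊞ (if b then Zᵉ (2 + i) else 0ˢ))) ≋
        scale i (ahead (suc i))
      -- Going to the leaf and back replaces the loop, so this is the equation for Γ′ multiplied by
      -- c_{i+1}.
      balance false ¬asc = begin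
        scale i backward ⊞ (scale (suc i) (ahead (2 + i)) ⊞ (τ (2 + i) (scale i (ahead (suc i))) ⊞ 0ˢ))
          ≈⟨ S.∙-congˡ (S.∙-cong
               (S.reflexive (scale-false i ¬asc))
               (S.trans (S.identityʳ _) (S.trans (S.sym (scale-act i (y (odd (2 + i))) (ahead (suc i)))) (scale-cong i (act-cong (λ _ → R.refl) (ahead-¬ascent i ¬asc)))))) ⟩
        scale i backward ⊞ (scale i (ahead (2 + i)) ⊞ scale i (τ (2 + i) (z (2 + i))))
          ≈⟨ S.trans (S.∙-congˡ (S.sym (scale-⊞ i _ _))) (S.sym (scale-⊞ i _ _)) ⟩
        scale i (backward ⊞ (ahead (2 + i) ⊞ τ (2 + i) (z (2 + i))))
          ≈⟨ scale-cong i (S.trans (S.sym (equation i i<r)) (S.sym (ahead-¬ascent i ¬asc))) ⟩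
        scale i (ahead (suc i)) ∎
      -- The step to the odd vertex contributes t y_{2i+3} (S_{i+1} + S_{i+2}), the loop term at
      -- z_{i+2}. What remains, S_{i+1} = backward + loop, is the equation for Γ′ with S_{i+2}
      -- subtracted from both sides.
      balance true asc = begin
        scale i backward ⊞ (0ˢ ⊞ (τ (2 + i) (scale i (ahead (suc i))) ⊞ scale (suc i) (ahead (2 + i))))
          ≈⟨ S.∙-congˡ (S.trans (S.identityˡ _) (S.∙-congˡ (S.reflexive (scale-true i asc)))) ⟩
        scale i backward ⊞ (τ (2 + i) (scale i (ahead (suc i))) ⊞ τ (2 + i) (scale i (ahead (2 + i))))
          ≈⟨ S.∙-congˡ (S.trans
               (S.∙-cong (S.sym (scale-act i (y (odd (2 + i))) (ahead (suc i)))) (S.sym (scale-act i (y (odd (2 + i))) (ahead (2 + i)))))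
               (S.trans (S.sym (scale-⊞ i _ _)) (scale-cong i (S.trans (S.sym (act-+ _ _ _)) (act-cong (λ _ → R.refl) (ahead-ascent i asc)))))) ⟩
        scale i backward ⊞ scale i (τ (2 + i) (z (2 + i)))
          ≈⟨ scale-⊞ i _ _ ⟨
        scale i (backward ⊞ τ (2 + i) (z (2 + i)))
          ≈⟨ scale-cong i (cancelled (S.trans (ahead-ascent i asc) (S.trans (equation i i<r)
               (solve 3 (λ b s t → b ⊕ (s ⊕ t) ⊜ (b ⊕ t) ⊕ s) S.refl backward (ahead (2 + i)) (τ (2 + i) (z (2 + i))))))) ⟨
        scale i (ahead (suc i)) ∎
        where
        cancelled : ∀ {f g h} → f ⊞ h ≋ g ⊞ h → f ≋ g
        cancelled {f} {g} {h} = AbelianGroupProperties.∙-cancelʳ series h f g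

    row-later : ∀ x → x < 2 * r → Z (2 + x) ≋ out Z Γ (2 + x)
    row-later x x<2r with parity x
    ... | inj₁ (i , ≡.refl) = ≡.subst (λ x → Z x ≋ out Z Γ x) (≡.cong suc (ℕ.+-suc i (i + 0)))
      (row-even i (ℕ.*-cancelˡ-< 2 i r x<2r))
    ... | inj₂ (i , ≡.refl) = ≡.subst (λ x → Z x ≋ out Z Γ x) (≡.cong (λ x → suc (suc x)) (ℕ.+-suc i (i + 0)))
      (row-odd i (ℕ.*-cancelˡ-< 2 i r (ℕ.<⇒≤ x<2r)))

  -- Comparison of the two resolvents

  open Transfer T (transfer-linear 0 Γ-admissible) (transfer-lower 0 Γ-admissible) public
    using () renaming (Gₜ to GΓ; IsRow to IsRowΓ; row-unique to Γ-row-unique; Gₜ-row to GΓ-row; resolvent to Γ-resolvent)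
  open Transfer T′ (transfer-linear 1 Γ′-admissible) (transfer-lower 1 Γ′-admissible) public
    using () renaming (Gₜ to GΓ′; Gₜ-row to GΓ′-row; resolvent to Γ′-resolvent)

  pad : ∀ {N} → (Fin N → Series) → ℕ → Series
  pad {zero}  f x       = 0ˢ
  pad {suc N} f zero    = f zero
  pad {suc N} f (suc x) = pad (f ∘ suc) x

  pad-toℕ : ∀ {N} (f : Fin N → Series) i → pad f (toℕ i) ≡ f i
  pad-toℕ f zero    = ≡.refl
  pad-toℕ f (suc i) = pad-toℕ (f ∘ suc) i

  pad-beyond : ∀ {N} (f : Fin N → Series) {x} → N ≤ x → pad f x ≋ 0ˢ
  pad-beyond {zero}  f         _         = S.refl
  pad-beyond {suc N} f {suc x} (s≤s N≤x) = pad-beyond (f ∘ suc) N≤x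

  -- The numbers of Γ′ start at 1; the value at 0 has to vanish for `row-sum`.
  z : ℕ → Series
  z zero    = 0ˢ
  z (suc x) = pad (GΓ′ zero) x

  z-beyond : ∀ x → suc r < x → z x ≋ 0ˢ
  z-beyond (suc x) (s≤s r<x) = pad-beyond (GΓ′ zero) r<x

  z-row : ∀ i → z (suc (toℕ i)) ≋ Iₜ zero i ⊞ out z Γ′ (suc (toℕ i))
  z-row i n = R.trans (R.reflexive (≡.cong (λ f → f n) (pad-toℕ (GΓ′ zero) i))) (R.trans (GΓ′-row zero i n) (R.+-congˡ
    (R.trans
      (sum-cong-≋ {suc r} λ b → R.reflexive (≡.cong (λ f → act (T′ b i) f n) (≡.sym (pad-toℕ (GΓ′ zero) b))))
      (row-sum {suc r} 1 z (λ { zero _ → S.refl ; (suc _) (s≤s ()) }) (λ x → z-beyond x) Γ′ i n))))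
    where open SemiringSum R.semiring using (sum-cong-≋)

  open Row z z-beyond (z-row zero)
    (λ i i<r → ≡.subst (λ x → z (2 + x) ≋ out z Γ′ (2 + x)) (Fin.toℕ-fromℕ< i<r)
      (S.trans (z-row (suc (fromℕ< i<r))) (S.trans (S.∙-congʳ 0ₜ≈0) (S.identityˡ _))))

  Z-row : IsRowΓ (suc zero) (Z ∘ toℕ)
  Z-row a n = R.trans (rows a n) (R.+-congˡ (R.sym (row-sum {2 + 2 * r} 0 Z (λ _ ()) Z-beyond Γ a n)))
    where
    rows : ∀ a → Z (toℕ a) ≋ Iₜ (suc zero) a ⊞ out Z Γ (toℕ a)
    rows zero          = S.trans row-0 (S.sym (S.trans (S.∙-congʳ 0ₜ≈0) (S.identityˡ _)))
    rows (suc zero)    = row-1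
    rows (suc (suc a)) = S.trans (row-later (toℕ a) (Fin.toℕ<n a)) (S.sym (S.trans (S.∙-congʳ 0ₜ≈0) (S.identityˡ _)))

  partition-functions : GΓ (suc zero) (suc zero) ≋ GΓ′ zero zero
  partition-functions = Γ-row-unique {suc zero} {GΓ (suc zero)} {Z ∘ toℕ} (GΓ-row (suc zero)) Z-row (suc zero)

theorem6p1 : ∀ {c ℓ₁ ℓ₂ : Level} (F : HeytingField c ℓ₁ ℓ₂) (r : ℕ) → 1 ≤ r →
    (Q : FieldDefs.QSystem F r) (m : Vec ℤ r) → IsMotzkin m →
    let open HeytingField F using (_≈_)
        open FieldDefs F
        open Graphs m (SkeletonWeights.y Q m) in
    Σ[ G ∈ Resolvent T ] Σ[ G′ ∈ Resolvent T′ ]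
      (∀ n → proj₁ G (suc zero) (suc zero) n ≈ proj₁ G′ zero zero n)
theorem6p1 F r _ Q m _ = Γ-resolvent , Γ′-resolvent , partition-functions
  where open Compactification F m (FieldDefs.SkeletonWeights.y F Q m)
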